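{- For $n\geq1$, $$R_{n+1}(x,q)=2nxR_n(x,q)+2x(1-x)\frac{\partial}{\partial x}R_n(x,q)+2nxqR_{n-1}(x,q),$$ with $R_0(x,q)=1$, $R_1(x,q)=0$, $R_2(x,q)=2qx$, $R_3(x,q)=4qx(1+x)$.
   Context: Let $[n]_2=\{1,1,\ldots,n,n\}$. A Stirling permutation of order $k$ is a permutation of $[k]_2$ such that for each $i$ every entry between the two occurrences of $i$ is greater than $i$; $\mathcal{Q}_k$ denotes their set. For a word $\omega$, ${\rm red}(\omega)$ replaces each occurrence of the $i$th smallest distinct value by $i$. A Stirling permutation of the second kind of order $n$ is a permutation $\sigma$ of $[n]_2$ written as a nonempty disjoint union of cycles in standard cycle form such that: (i) the two copies of each $i\in[n]$ lie in the same cycle; (ii) each cycle is written with one of its smallest entries first and cycles are in increasing order of smallest entries; (iii) for each cycle $(c_1,\ldots,c_{2k})$, ${\rm red}(c_1\cdots c_{2k})\in\mathcal{Q}_k$. $\mathcal{Q}_n^2$ is the set of these. A fixed point of $\sigma$ is $k\in[n]$ such that $(kk)$ is a cycle of $\sigma$; $\sigma$ is a Stirling derangement if it has no fixed points, and $\mathcal{DQ}_n$ is the set of Stirling derangements in $\mathcal{Q}_n^2$. For a cycle $(c_1,\ldots,c_{2k})$ with $k\ge2$, an entry $c_i$ with $2\le i\le 2k-1$ is a cycle ascent plateau if $c_{i-1}<c_i=c_{i+1}$; ${\rm cap}(\sigma)$ is their total number in $\sigma$ and ${\rm cyc}(\sigma)$ is the number of cycles. $R_n(x,q)=\sum_{\sigma\in\mathcal{DQ}_n}x^{{\rm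 cap}(\sigma)}q^{{\rm cyc}(\sigma)}$ for $n\ge1$, and $R_0(x,q)=1$. -}

module Defs where

open import Data.Bool using (Bool; true; false; _∧_; _∨_; not; if_then_else_)
open import Data.Nat using (ℕ; zero; suc; _+_; _*_; _∸_; _≡ᵇ_; _<ᵇ_)
open import Data.List using (List; []; _∷_; length; map; concatMap; filter; filterᵇ; lookup; deduplicate; applyUpTo)
open import Data.Bool.ListAction using (all; any)
open import Data.Nat.ListAction using (sum)
import Data.List as L
open import Data.Fin using (Fin; toℕ)
open import Data.Product using (_×_; _,_)
open import Data.Integer using (ℤ; +_; _-_) renaming (_+_ to _+ℤ_; _*_ to _*ℤ_)
open import Relation.Binary.PropositionalEquality using (_≡_)
open import Relation.Nullary.Decidable using (⌊_⌋)
import Data.Nat as N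

Word : Set
Word = List ℕ

occ : ℕ → Word → ℕ
occ v w = length (filter (λ x → x N.≟ v) w)

_≤ᵇ'_ : ℕ → ℕ → Bool
a ≤ᵇ' b = a <ᵇ suc b

-- red(ω): replace each occurrence of the i-th smallest distinct value by i
red : Word → Word
red w = map (λ x → length (filter (λ y → y N.≤? x) (deduplicate N._≟_ w))) w

oneTo : ℕ → List ℕ
oneTo k = applyUpTo suc k

isPermOf2 : ℕ → Word → Bool
isPermOf2 k w = (length w ≡ᵇ (2 * k)) ∧ all (λ i → occ i w ≡ᵇ 2) (oneTo k)

stirlingCond : Word → Bool
stirlingCond w =
  all (λ a → all (λ b → all (λ c →
        not ((toℕ a <ᵇ toℕ b) ∧ (toℕ b <ᵇ toℕ c) ∧ (lookup w a ≡ᵇ lookup w c))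
        ∨ (lookup w a <ᵇ lookup w b))
      (L.allFin (length w))) (L.allFin (length w))) (L.allFin (length w))

inQ : ℕ → Word → Bool
inQ k w = isPermOf2 k w ∧ stirlingCond w

-- A permutation of [n]_2 written as a list of cycles (standard cycle form).

Cycles : Set
Cycles = List Word

head0 : Word → ℕ
head0 []      = 0
head0 (x ∷ _) = x

-- (i): both copies of each value lie in the same cycle
--      (each value occurring in a cycle occurs there twice)
condI : Cycles → Bool
condI σ = all (λ c → all (λ x → occ x c ≡ᵇ 2) c) σ

firstIsMin : Word → Bool
firstIsMin []      = false
firstIsMin (x ∷ c) = all (λ y → x ≤ᵇ' y) c

increasingHeads : Cycles → Bool
increasingHeads []            = true
increasingHeads (c ∷ [])      = true
increasingHeads (c ∷ d ∷ σ)   = (head0 c <ᵇ head0 d) ∧ increasingHeads (d ∷ σ)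

condII : Cycles → Bool
condII σ = all firstIsMin σ ∧ increasingHeads σ

halfLen : Word → ℕ
halfLen c = length c N./ 2

condIII : Cycles → Bool
condIII σ = all (λ c → inQ (halfLen c) (red c)) σ

inQ2 : ℕ → Cycles → Bool
inQ2 n σ = not (L.null σ) ∧ isPermOf2 n (L.concat σ) ∧ condI σ ∧ condII σ ∧ condIII σ

isFixedCycle : Word → Bool
isFixedCycle (a ∷ b ∷ []) = a ≡ᵇ b
isFixedCycle _            = false

isDerangement : Cycles → Bool
isDerangement σ = not (any isFixedCycle σ)

inDQ : ℕ → Cycles → Bool
inDQ n σ = inQ2 n σ ∧ isDerangement σ

capCycle : Word → ℕ
capCycle (a ∷ b ∷ c ∷ rest) =
  (if (a <ᵇ b) ∧ (b ≡ᵇ c) then 1 else 0) + capCycle (b ∷ c ∷ rest)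
capCycle _ = 0

cap : Cycles → ℕ
cap σ = sum (map capCycle σ)

cyc : Cycles → ℕ
cyc σ = length σ

-- A finite list of candidates containing every element of 𝒬²_n exactly once
-- (in its standard cycle form): all words of length 2n over [n], each cut
-- in all possible ways into consecutive nonempty blocks.

wordsOver : List ℕ → ℕ → List Word
wordsOver A zero    = [] ∷ []
wordsOver A (suc m) = concatMap (λ a → map (a ∷_) (wordsOver A m)) A

splits : Word → List Cycles
splits []       = [] ∷ []
splits (x ∷ xs) = concatMap (λ s → join s) (splits xs)
  where
  join : Cycles → List Cycles
  join []       = ((x ∷ []) ∷ []) ∷ []
  join (b ∷ bs) = ((x ∷ []) ∷ b ∷ bs) ∷ ((x ∷ b) ∷ bs) ∷ []

candidates : ℕ → List Cycles
candidates n = concatMap splits (wordsOver (oneTo n) (2 * n))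

-- Bivariate polynomials / formal series in x, q with integer coefficients,
-- represented by their coefficient function: p i j = [x^i q^j] p.

Poly : Set
Poly = ℕ → ℕ → ℤ

-- R_n(x,q) = Σ_{σ ∈ 𝒟𝒬_n} x^{cap σ} q^{cyc σ},  R_0 = 1
R : ℕ → Poly
R zero    zero zero = + 1
R zero    _    _    = + 0
R (suc n) i    j    =
  + length (filterᵇ (λ σ → inDQ (suc n) σ ∧ (cap σ ≡ᵇ i) ∧ (cyc σ ≡ᵇ j))
                    (candidates (suc n)))

_≈P_ : Poly → Poly → Set
p ≈P r = ∀ i j → p i j ≡ r i j

0P : Poly
0P _ _ = + 0

1P : Poly
1P zero zero = + 1
1P _    _    = + 0

_+P_ : Poly → Poly → Poly
(p +P r) i j = p i j +ℤ r i j

_-P_ : Poly → Poly → Poly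
(p -P r) i j = p i j - r i j

_·P_ : ℕ → Poly → Poly
(c ·P p) i j = + c *ℤ p i j

xP : Poly → Poly
xP p zero    j = + 0
xP p (suc i) j = p i j

qP : Poly → Poly
qP p i zero    = + 0
qP p i (suc j) = p i j

dx : Poly → Poly
dx p i j = + (suc i) *ℤ p (suc i) j

infixl 6 _+P_ _-P_
infixl 7 _·P_
infix 4 _≈P_

{-# OPTIONS --safe #-}
module Submission where

-- Deleting the two (adjacent) copies of the largest letter is the inverse of inserting
-- them after some letter or as a new last cycle, so this insertion generates 𝒬²_n.
-- Inserting into a cycle creates one ascent plateau, and destroys one exactly when made
-- at one of its two places; this gives a recurrence for the numbers A_n(i,j,f) of
-- elements with i cycle ascent plateaux, j cycles and f fixed points.  It involves
-- derangements of the form f = 0 together with A_n(i,j,1).  The latter is eliminated by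
-- (f+1) A_{n+1}(i,j+1,f+1) = (n+1) A_n(i,j,f) (mark a fixed point and remove it), which
-- itself follows from the recurrence by induction on n, without any relabelling.

open import Defs
open import Data.Bool using (Bool; true; false; T; not; _∧_; _∨_; if_then_else_)
open import Data.Bool.ListAction using (all)
open import Data.Bool.Properties using (T?; T-≡; T-∧; ∧-zeroʳ)
open import Data.Fin using (Fin; toℕ) renaming (zero to fzero; suc to fsuc)
open import Data.Integer using () renaming (+_ to pos; _+_ to _+ℤ_; _*_ to _*ℤ_; _-_ to _-ℤ_)
import Data.Integer.Properties as ℤ
import Data.Integer.Tactic.RingSolver as ℤ using (solve-∀)
open import Data.List using (List; []; _∷_; _++_; map; concat; concatMap; length; filter;
  filterᵇ; deduplicate; lookup; null; allFin)
open import Data.List.Membership.Propositional using (_∈_; find; lose)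
open import Data.List.Membership.Propositional.Properties
open import Data.List.Membership.Propositional.Properties.WithK using (unique∧set⇒bag)
open import Data.List.Properties using (map-∘; map-++; length-++; length-map; length-filter;
  map-cong-local; concatMap-cong; ∷-injectiveˡ; ∷-injectiveʳ; filter-accept; filter-reject;
  filter-none; filter-all; filter-++)
open import Data.List.Relation.Binary.BagAndSetEquality using (∼bag⇒↭)
open import Data.List.Relation.Binary.Permutation.Propositional
  using (_↭_; ↭-refl; ↭-sym; ↭-trans; ↭-prep)
open import Data.List.Relation.Binary.Permutation.Propositional.Properties as ↭
  using (↭-length; filter-↭; All-resp-↭; ∈-resp-↭; shifts; ++⁺ˡ; ++⁺ʳ)
open import Data.List.Relation.Binary.Pointwise using (Pointwise-≡⇒≡)
open import Data.List.Relation.Binary.Sublist.Propositional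
  using (_⊆_; []; _∷_; _∷ʳ_; ⊆-refl; ⊆-trans; from∈; to∈; minimum)
open import Data.List.Relation.Binary.Sublist.Propositional.Properties as ⊆
  using (length-mono-≤; to-≋)
open import Data.List.Relation.Unary.All as All using (All; []; _∷_)
import Data.List.Relation.Unary.All.Properties as All
open import Data.List.Relation.Unary.AllPairs using ([]; _∷_)
open import Data.List.Relation.Unary.Any as Any using (here; there)
open import Data.List.Relation.Unary.Linked as Linked using (Linked; []; [-]; _∷_)
open import Data.List.Relation.Unary.Unique.DecPropositional.Properties using (deduplicate-!)
open import Data.List.Relation.Unary.Unique.Propositional using (Unique)
import Data.List.Relation.Unary.Unique.Propositional.Properties as Unique
open import Data.Nat
open import Data.Nat.DivMod using (m/n≡1+[m∸n]/n)
open import Data.Nat.ListAction using (sum)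
open import Data.Nat.ListAction.Properties using (sum-++; sum-↭)
open import Data.Nat.Properties
open import Data.Nat.Tactic.RingSolver using (solve-∀)
open import Data.List.Membership.DecPropositional _≟_ using (_∈?_)
open import Data.Product using (_×_; _,_; proj₁; proj₂; ∃; ∃₂)
open import Data.Sum using (inj₁; inj₂)
open import Function using (_∘_; Equivalence; mk⇔)
open import Relation.Binary.Definitions using (tri<; tri≈; tri>)
open import Relation.Binary.PropositionalEquality
open import Relation.Nullary using (¬_; yes; no; contradiction; ¬?)

-- Of the 2n letters of σ after which the new pair can go, 2 cap(σ) keep the number of plateaux, 2
-- fix(σ) lie in a fixed cycle, which gains a plateau and is no longer fixed, and the rest only gain
-- a plateau. With y marking fixed points, the generating functions F_n(x,q,y) therefore satisfy
-- F_{n+1} = (2nx + qy) F_n + 2x(1-x) ∂F_n/∂x + 2x(1-y) ∂F_n/∂y, and R_n is F_n at y = 0. The only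
-- term there that is not expressed by R_n is ∂F_n/∂y at y = 0; the relation for marked fixed points
-- is the Appell property ∂F_{n+1}/∂y = (n+1) q F_n, which removes it. Counts are natural numbers,
-- so identities are kept in additive form, with the negative terms moved to the other side, until
-- the passage to integer coefficients. Since R_n is defined by filtering candidates, the insertion
-- tree is compared with it as a second list without repetitions that has the same elements.

insertions : ℕ → Word → List Word
insertions N []       = []
insertions N (x ∷ xs) = map (x ∷_) ((N ∷ N ∷ xs) ∷ insertions N xs)

-- Nothing is inserted in front of the first letter of a cycle, which thus remains its minimum, and
-- `N` opens a new cycle only at the end, where the heads stay increasing. A list of cycles with l
-- letters has l + 1 children.
children : ℕ → Cycles → List Cycles
children N []      = ((N ∷ N ∷ []) ∷ []) ∷ []
children N (c ∷ σ) = map (_∷ σ) (insertions N c) ++ map (c ∷_) (children N σ)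

-- At `zero` the empty list of cycles realises the convention that R_0 is 1. It is rejected by
-- `inQ2`, so the comparison with the candidates is made for `suc n` only.
generated : ℕ → List Cycles
generated zero    = [] ∷ []
generated (suc n) = concatMap (children (suc n)) (generated n)

⟦_⟧ : Bool → ℕ
⟦ b ⟧ = if b then 1 else 0

fix : Cycles → ℕ
fix σ = sum (map (⟦_⟧ ∘ isFixedCycle) σ)

-- Weighted sums over insertions

∑ : {A : Set} → List A → (A → ℕ) → ℕ
∑ xs f = sum (map f xs)

∑-map : {A B : Set} (g : A → B) (f : B → ℕ) (xs : List A) →
        ∑ (map g xs) f ≡ ∑ xs (f ∘ g)
∑-map g f xs = cong sum (sym (map-∘ xs))

∑-++ : {A : Set} (f : A → ℕ) (xs ys : List A) → ∑ (xs ++ ys) f ≡ ∑ xs f + ∑ ys f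
∑-++ f xs ys = trans (cong sum (map-++ f xs ys)) (sum-++ (map f xs) (map f ys))

∑-concatMap : {A B : Set} (g : A → List B) (f : B → ℕ) (xs : List A) →
              ∑ (concatMap g xs) f ≡ ∑ xs (λ x → ∑ (g x) f)
∑-concatMap g f []       = refl
∑-concatMap g f (x ∷ xs) =
  trans (∑-++ f (g x) (concatMap g xs)) (cong (∑ (g x) f +_) (∑-concatMap g f xs))

T⇒true : ∀ {b} → T b → b ≡ true
T⇒true = Equivalence.to T-≡

¬T⇒false : ∀ {b} → ¬ T b → b ≡ false
¬T⇒false {false} _  = refl
¬T⇒false {true}  ¬t with () ← ¬t _

<⇒<ᵇ≡true : ∀ {m n} → m < n → (m <ᵇ n) ≡ true
<⇒<ᵇ≡true m<n = T⇒true (<⇒<ᵇ m<n)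

≥⇒<ᵇ≡false : ∀ {m n} → n ≤ m → (m <ᵇ n) ≡ false
≥⇒<ᵇ≡false n≤m = ¬T⇒false (λ t → ≤⇒≯ n≤m (<ᵇ⇒< _ _ t))

≡ᵇ-refl : ∀ n → (n ≡ᵇ n) ≡ true
≡ᵇ-refl n = T⇒true (≡⇒≡ᵇ n n refl)

≢⇒≡ᵇ≡false : ∀ {m n} → m ≢ n → (m ≡ᵇ n) ≡ false
≢⇒≡ᵇ≡false m≢n = ¬T⇒false (λ t → m≢n (≡ᵇ⇒≡ _ _ t))

∧-trueʳ : ∀ {a b} → a ∧ b ≡ true → b ≡ true
∧-trueʳ {true} eq = eq

capCycle-descent : ∀ {x y} w → y ≤ x → capCycle (x ∷ y ∷ w) ≡ capCycle (y ∷ w)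
capCycle-descent []      y≤x = refl
capCycle-descent (z ∷ w) y≤x rewrite ≥⇒<ᵇ≡false y≤x = refl

capCycle-head-max : ∀ {N} w → All (_< N) w → capCycle (N ∷ w) ≡ capCycle w
capCycle-head-max []      _         = refl
capCycle-head-max (y ∷ w) (y<N ∷ _) = capCycle-descent w (<⇒≤ y<N)

-- After the new plateau `x < N = N` the step down from `N` contributes nothing, and `x` no longer
-- precedes `w`: a plateau of `x ∷ w` with lower neighbour `x` is lost, hence `capCycle w` on the
-- right.
capCycle-insert : ∀ {N x} w → x < N → All (_< N) w →
                  capCycle (x ∷ N ∷ N ∷ w) ≡ suc (capCycle w)
capCycle-insert {N} {x} w x<N w<N
  rewrite <⇒<ᵇ≡true x<N | ≡ᵇ-refl N =
  cong suc (trans (capCycle-descent {N} w ≤-refl) (capCycle-head-max w w<N))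

-- Inserting at one of the two places of a plateau (before or between its letters) keeps
-- the number of plateaux, and inserting anywhere else raises it by one.  Terms are moved
-- so that the number length w − 2 cap w of other places needs no subtraction.
CapInsertions : ℕ → Word → Set
CapInsertions N w = (φ : ℕ → ℕ) →
  ∑ (insertions N w) (φ ∘ capCycle) + 2 * capCycle w * φ (suc (capCycle w))
  ≡ 2 * capCycle w * φ (capCycle w) + length w * φ (suc (capCycle w))

-- The induction removes `x`, whose only influence is the indicator of the triple `x`, `y`, `z`.
-- Insertions after `z` or later keep this triple, so the indicator merely shifts their statistic;
-- quantifying over all `φ` absorbs the shift.
cap-insertions-step : ∀ {N} x y z r → All (_< N) (x ∷ y ∷ z ∷ r) →
  CapInsertions N (y ∷ z ∷ r) → CapInsertions N (x ∷ y ∷ z ∷ r)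
cap-insertions-step {N} x y z r (x<N ∷ y<N ∷ z<N ∷ r<N) hyp φ = split _ refl
  where
  b = capCycle (y ∷ z ∷ r)
  V = (N ∷ N ∷ r) ∷ insertions N r
  S : (ℕ → ℕ) → ℕ
  S ψ = ∑ V (λ v → ψ (capCycle (y ∷ z ∷ v)))
  ih : ∀ ψ → ψ (suc (capCycle (z ∷ r))) + S ψ + 2 * b * ψ (suc b)
             ≡ 2 * b * ψ b + length (y ∷ z ∷ r) * ψ (suc b)
  ih ψ = trans (cong (_+ 2 * b * ψ (suc b)) (sym unfold)) (hyp ψ)
    where
    unfold : ∑ (insertions N (y ∷ z ∷ r)) (ψ ∘ capCycle)
             ≡ ψ (suc (capCycle (z ∷ r))) + S ψ
    unfold = cong₂ _+_ (cong ψ (capCycle-insert (z ∷ r) y<N (z<N ∷ r<N)))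
      (trans (∑-map (y ∷_) (ψ ∘ capCycle) (map (z ∷_) V))
             (∑-map (z ∷_) (ψ ∘ capCycle ∘ (y ∷_)) V))
  expand : ∑ (insertions N (x ∷ y ∷ z ∷ r)) (φ ∘ capCycle)
           ≡ φ (suc b) + (φ (suc (capCycle (z ∷ r)))
             + S (λ t → φ (⟦ (x <ᵇ y) ∧ (y ≡ᵇ z) ⟧ + t)))
  expand = cong₂ _+_ (cong φ (capCycle-insert (y ∷ z ∷ r) x<N (y<N ∷ z<N ∷ r<N)))
    (trans (∑-map (x ∷_) (φ ∘ capCycle) (map (y ∷_) ((N ∷ N ∷ z ∷ r) ∷ map (z ∷_) V)))
    (trans (∑-map (y ∷_) (φ ∘ capCycle ∘ (x ∷_)) ((N ∷ N ∷ z ∷ r) ∷ map (z ∷_) V))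
    (cong₂ _+_ (cong φ second) (∑-map (z ∷_) (φ ∘ capCycle ∘ (x ∷_) ∘ (y ∷_)) V))))
    where
    -- A pair put after `y` breaks a possible plateau `x < y = z`: the triple becomes `x`, `y`, `N`
    -- with `y < N`.
    second : capCycle (x ∷ y ∷ N ∷ N ∷ z ∷ r) ≡ suc (capCycle (z ∷ r))
    second rewrite ≢⇒≡ᵇ≡false (<⇒≢ y<N) | ∧-zeroʳ (x <ᵇ y) =
      capCycle-insert (z ∷ r) y<N (z<N ∷ r<N)
  no-plateau : ∀ p q s t u l → q + s + t ≡ u + l * p →
               p + (q + s) + t ≡ u + (p + l * p)
  no-plateau p q s t u l eq = trans (+-assoc p (q + s) t)
    (trans (cong (p +_) eq) (solve p u (l * p)))
    where
    solve : ∀ p u m → p + (u + m) ≡ u + (p + m)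
    solve = solve-∀
  plateau : ∀ c p₁ p₂ s l → p₂ + s + 2 * c * p₂ ≡ 2 * c * p₁ + l * p₂ →
            p₁ + (p₁ + s) + 2 * suc c * p₂ ≡ 2 * suc c * p₁ + (p₂ + l * p₂)
  plateau c p₁ p₂ s l eq = trans (lhs c p₁ p₂ s)
    (trans (cong (2 * p₁ + p₂ +_) eq) (rhs c p₁ p₂ (l * p₂)))
    where
    lhs : ∀ c p₁ p₂ s → p₁ + (p₁ + s) + 2 * suc c * p₂
                        ≡ 2 * p₁ + p₂ + (p₂ + s + 2 * c * p₂)
    lhs = solve-∀
    rhs : ∀ c p₁ p₂ m → 2 * p₁ + p₂ + (2 * c * p₁ + m)
                        ≡ 2 * suc c * p₁ + (p₂ + m)
    rhs = solve-∀
  split : ∀ e → (x <ᵇ y) ∧ (y ≡ᵇ z) ≡ e →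
    ∑ (insertions N (x ∷ y ∷ z ∷ r)) (φ ∘ capCycle)
      + 2 * capCycle (x ∷ y ∷ z ∷ r) * φ (suc (capCycle (x ∷ y ∷ z ∷ r)))
    ≡ 2 * capCycle (x ∷ y ∷ z ∷ r) * φ (capCycle (x ∷ y ∷ z ∷ r))
      + length (x ∷ y ∷ z ∷ r) * φ (suc (capCycle (x ∷ y ∷ z ∷ r)))
  split e eq rewrite expand | eq with e
  ... | false = no-plateau (φ (suc b)) (φ (suc (capCycle (z ∷ r)))) (S φ)
                  (2 * b * φ (suc b)) (2 * b * φ b) (length (y ∷ z ∷ r)) (ih φ)
  -- Both places of the plateau, after `x` and after `y`, yield `suc b`, the value before insertion.
  -- The other insertions carry the extra plateau along, so the hypothesis is used for `φ ∘ suc`.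
  ... | true  = trans (cong (λ t → φ (suc b) + (φ (suc t) + S (φ ∘ suc)) + 2 * suc b * φ (suc (suc b))) zr)
      (plateau b (φ (suc b)) (φ (suc (suc b))) (S (φ ∘ suc)) (length (y ∷ z ∷ r))
        (trans (cong (λ t → φ (suc (suc t)) + S (φ ∘ suc) + 2 * b * φ (suc (suc b))) (sym zr))
          (ih (φ ∘ suc))))
    where
    zr : capCycle (z ∷ r) ≡ b
    zr = sym (capCycle-descent r (≤-reflexive (sym (≡ᵇ⇒≡ y z
           (Equivalence.from T-≡ (∧-trueʳ {x <ᵇ y} eq))))))

cap-insertions : ∀ {N} w → All (_< N) w → CapInsertions N w
cap-insertions []           _                φ = refl
cap-insertions (x ∷ [])     (x<N ∷ _)        φ
  rewrite capCycle-insert [] x<N [] = +-identityʳ _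
cap-insertions (x ∷ y ∷ []) (x<N ∷ y<N ∷ []) φ
  rewrite capCycle-insert (y ∷ []) x<N (y<N ∷ [])
        | ≢⇒≡ᵇ≡false (<⇒≢ y<N) | ∧-zeroʳ (x <ᵇ y)
        | capCycle-insert [] y<N [] = +-identityʳ _
cap-insertions (x ∷ y ∷ z ∷ r) (x<N ∷ y<N ∷ z<N ∷ r<N) =
  cap-insertions-step x y z r (x<N ∷ y<N ∷ z<N ∷ r<N)
    (cap-insertions (y ∷ z ∷ r) (y<N ∷ z<N ∷ r<N))

∑-cong : {A : Set} {f g : A → ℕ} {xs : List A} →
         All (λ x → f x ≡ g x) xs → ∑ xs f ≡ ∑ xs g
∑-cong []         = refl
∑-cong (eq ∷ eqs) = cong₂ _+_ eq (∑-cong eqs)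

length-insertions : ∀ N w → All (λ v → 3 ≤ length v) (insertions N w)
length-insertions N []       = []
length-insertions N (x ∷ xs) =
  All.map⁺ (s≤s (s≤s (s≤s z≤n)) ∷ All.map m≤n⇒m≤1+n (length-insertions N xs))

isFixedCycle-long : ∀ w → 3 ≤ length w → isFixedCycle w ≡ false
isFixedCycle-long (_ ∷ _ ∷ _ ∷ _) _ = refl
isFixedCycle-long (_ ∷ _ ∷ []) (s≤s (s≤s ()))
isFixedCycle-long (_ ∷ []) (s≤s ())

statistic : (ℕ → ℕ → ℕ → ℕ) → Cycles → ℕ
statistic φ σ = φ (cap σ) (cyc σ) (fix σ)

-- Behind a fixed cycle `pred g` is raised to `suc (pred g)`. This agrees with `g` except at `zero`,
-- where the factor vanishes.
pred-absorb : ∀ (ψ : ℕ → ℕ) g → 2 * g * ψ (suc (pred g)) ≡ 2 * g * ψ g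
pred-absorb ψ zero    = refl
pred-absorb ψ (suc g) = refl

-- The value of pred at g = 0 is immaterial, since its term has the factor g.
ChildrenSum : ℕ → Cycles → Set
ChildrenSum N σ = ∀ φ →
  let a = cap σ; c = cyc σ; g = fix σ in
  ∑ (children N σ) (statistic φ) + (2 * a + 2 * g) * φ (suc a) c g
  ≡ 2 * a * φ a c g + length (concat σ) * φ (suc a) c g
    + 2 * g * φ (suc a) c (pred g) + φ a (suc c) (suc g)

-- A child changes either `w`, where `CapInsertions` applies with the statistics of `τ` as
-- parameters, or `τ`, where the hypothesis is taken for `φ` shifted by the statistics of `w`.
children-sum-∷ : ∀ {N} w τ → All (_< N) w → ChildrenSum N τ → ChildrenSum N (w ∷ τ)
children-sum-∷ {N} w τ w<N hyp φ = go w w<N (isFixedCycle w) refl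
  where
  aτ = cap τ
  cτ = cyc τ
  gτ = fix τ
  expand : ∀ w → ∑ (children N (w ∷ τ)) (statistic φ)
    ≡ ∑ (insertions N w) (λ v → φ (capCycle v + aτ) (suc cτ) gτ)
      + ∑ (children N τ) (statistic (λ i j f → φ (capCycle w + i) (suc j) (⟦ isFixedCycle w ⟧ + f)))
  expand w = trans (∑-++ (statistic φ) (map (_∷ τ) (insertions N w)) _) (cong₂ _+_
    (trans (∑-map (_∷ τ) (statistic φ) (insertions N w))
      (∑-cong (All.map (λ {v} long → cong (λ b → φ (capCycle v + aτ) (suc cτ) (⟦ b ⟧ + gτ))
                                      (isFixedCycle-long v long))
                       (length-insertions N w))))
    (∑-map (w ∷_) (statistic φ) (children N τ)))
  unfixed : ∀ S₁ S₂ w l L a g P Q R T →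
    S₁ + 2 * w * Q ≡ 2 * w * P + l * Q →
    S₂ + (2 * a + 2 * g) * Q ≡ 2 * a * P + L * Q + 2 * g * R + T →
    S₁ + S₂ + (2 * (w + a) + 2 * g) * Q
    ≡ 2 * (w + a) * P + (l + L) * Q + 2 * g * R + T
  unfixed S₁ S₂ w l L a g P Q R T e₁ e₂ =
    trans (lhs S₁ S₂ w a g Q) (trans (cong₂ _+_ e₁ e₂) (rhs w l L a g P Q R T))
    where
    lhs : ∀ S₁ S₂ w a g Q → S₁ + S₂ + (2 * (w + a) + 2 * g) * Q
          ≡ S₁ + 2 * w * Q + (S₂ + (2 * a + 2 * g) * Q)
    lhs = solve-∀
    rhs : ∀ w l L a g P Q R T →
          2 * w * P + l * Q + (2 * a * P + L * Q + 2 * g * R + T)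
          ≡ 2 * (w + a) * P + (l + L) * Q + 2 * g * R + T
    rhs = solve-∀
  fixed : ∀ S₁ S₂ L a g P Q R T →
    S₁ + 0 ≡ 2 * R →
    S₂ + (2 * a + 2 * g) * Q ≡ 2 * a * P + L * Q + 2 * g * R + T →
    S₁ + S₂ + (2 * a + 2 * suc g) * Q
    ≡ 2 * a * P + (2 + L) * Q + 2 * suc g * R + T
  fixed S₁ S₂ L a g P Q R T e₁ e₂ =
    trans (lhs S₁ S₂ a g Q) (trans (cong₂ (λ s t → s + t + 2 * Q) e₁ e₂) (rhs L a g P Q R T))
    where
    lhs : ∀ S₁ S₂ a g Q → S₁ + S₂ + (2 * a + 2 * suc g) * Q
          ≡ S₁ + 0 + (S₂ + (2 * a + 2 * g) * Q) + 2 * Q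
    lhs = solve-∀
    rhs : ∀ L a g P Q R T →
          2 * R + (2 * a * P + L * Q + 2 * g * R + T) + 2 * Q
          ≡ 2 * a * P + (2 + L) * Q + 2 * suc g * R + T
    rhs = solve-∀
  Claim : Word → Set
  Claim w = let a = capCycle w + aτ; c = suc cτ; g = ⟦ isFixedCycle w ⟧ + gτ in
    ∑ (children N (w ∷ τ)) (statistic φ) + (2 * a + 2 * g) * φ (suc a) c g
    ≡ 2 * a * φ a c g + length (concat (w ∷ τ)) * φ (suc a) c g
      + 2 * g * φ (suc a) c (pred g) + φ a (suc c) (suc g)
  go : ∀ w → All (_< N) w → ∀ b → isFixedCycle w ≡ b → Claim w
  go w w<N false eq rewrite expand w | eq | length-++ w {concat τ} =
    unfixed _ _ (capCycle w) (length w) (length (concat τ)) aτ gτ _ _ _ _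
      (cap-insertions w w<N (λ t → φ (t + aτ) (suc cτ) gτ))
      (subst (λ s → ∑ (children N τ) (statistic (λ i j → φ (capCycle w + i) (suc j)))
                    + (2 * aτ + 2 * gτ) * φ s (suc cτ) gτ
                    ≡ 2 * aτ * φ (capCycle w + aτ) (suc cτ) gτ
                      + length (concat τ) * φ s (suc cτ) gτ
                      + 2 * gτ * φ s (suc cτ) (pred gτ)
                      + φ (capCycle w + aτ) (suc (suc cτ)) (suc gτ))
        (+-suc (capCycle w) aτ)
        (hyp (λ i j → φ (capCycle w + i) (suc j))))
  -- Both insertions into a fixed cycle create one plateau and end its being fixed: two more copies
  -- of the `pred` term. Its two letters raise the length by 2, which the 2 contributed by the fixed
  -- point on the left offsets.
  go w@(x ∷ y ∷ []) w<N true eq rewrite expand w | eq =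
    fixed (∑ (insertions N w) (λ v → φ (capCycle v + aτ) (suc cτ) gτ)) _ (length (concat τ)) aτ gτ _ _ _ _
      (cap-insertions w w<N (λ t → φ (t + aτ) (suc cτ) gτ))
      (trans (hyp (λ i j f → φ i (suc j) (suc f)))
        (cong (λ t → 2 * aτ * φ aτ (suc cτ) (suc gτ) + length (concat τ) * φ (suc aτ) (suc cτ) (suc gτ)
                     + t + φ aτ (suc (suc cτ)) (suc (suc gτ)))
              (pred-absorb (φ (suc aτ) (suc cτ)) gτ)))

children-sum : ∀ {N} σ → All (All (_< N)) σ → ChildrenSum N σ
children-sum {N} []      []            φ rewrite ≡ᵇ-refl N = trans (+-identityʳ _) (+-identityʳ _)
children-sum     (w ∷ τ) (w<N ∷ τ<N)   =
  children-sum-∷ w τ w<N (children-sum τ τ<N)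

-- The candidate list

-- As `g` recovers the source from any of its images, the images of different sources share no
-- element.
concatMap-unique : {A B : Set} (f : A → List B) (g : B → A) {xs : List A} →
  Unique xs → All (Unique ∘ f) xs → (∀ {x y} → x ∈ xs → y ∈ f x → g y ≡ x) →
  Unique (concatMap f xs)
concatMap-unique f g []          []          inv = []
concatMap-unique f g {x ∷ xs} (x∉xs ∷ uxs) (ufx ∷ ufs) inv =
  Unique.++⁺ ufx (concatMap-unique f g uxs ufs (inv ∘ there)) disjoint
  where
  disjoint : ∀ {v} → ¬ (v ∈ f x × v ∈ concatMap f xs)
  disjoint (v∈fx , v∈rest) with find (∈-concatMap⁻ f v∈rest)
  ... | x′ , x′∈xs , v∈fx′ = All.lookup x∉xs x′∈xs
    (trans (sym (inv (here refl) v∈fx)) (inv (there x′∈xs) v∈fx′))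

wordsOver-unique : ∀ {A} m → Unique A → Unique (wordsOver A m)
wordsOver-unique     zero    uA = [] ∷ []
wordsOver-unique {A} (suc m) uA =
  concatMap-unique (λ a → map (a ∷_) (wordsOver A m)) head0 uA
    (All.tabulate (λ _ → Unique.map⁺ ∷-injectiveʳ (wordsOver-unique m uA)))
    (λ {a} _ → head0-≡ a)
  where
  head0-≡ : ∀ a {w} → w ∈ map (a ∷_) (wordsOver A m) → head0 w ≡ a
  head0-≡ a w∈ with ∈-map⁻ (a ∷_) w∈
  ... | _ , _ , refl = refl

∈-wordsOver⁺ : ∀ {A} w → All (_∈ A) w → w ∈ wordsOver A (length w)
∈-wordsOver⁺     []      []          = here refl
∈-wordsOver⁺ {A} (x ∷ w) (x∈A ∷ w⊆A) =
  ∈-concatMap⁺ (λ a → map (a ∷_) (wordsOver A (length w)))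
    (lose x∈A (∈-map⁺ (x ∷_) (∈-wordsOver⁺ w w⊆A)))

∈-wordsOver⁻ : ∀ {A} m {w} → w ∈ wordsOver A m → All (_∈ A) w
∈-wordsOver⁻     zero    (here refl) = []
∈-wordsOver⁻ {A} (suc m) w∈ with find (∈-concatMap⁻ (λ a → map (a ∷_) (wordsOver A m)) {xs = A} w∈)
... | a , a∈A , w∈′ with ∈-map⁻ (a ∷_) w∈′
...   | v , v∈ , refl = a∈A ∷ ∈-wordsOver⁻ m v∈

data NonEmpty : Word → Set where
  nonEmpty : ∀ {x w} → NonEmpty (x ∷ w)

-- A copy of the function local to splits, which has no name outside Defs.
attach : ℕ → Cycles → List Cycles
attach x []       = ((x ∷ []) ∷ []) ∷ []
attach x (b ∷ bs) = ((x ∷ []) ∷ b ∷ bs) ∷ ((x ∷ b) ∷ bs) ∷ []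

splits-∷ : ∀ x w → splits (x ∷ w) ≡ concatMap (attach x) (splits w)
splits-∷ x w = concatMap-cong (λ { [] → refl ; (b ∷ bs) → refl }) (splits w)

∈-splits-∷⁺ : ∀ x w {σ τ} → τ ∈ splits w → σ ∈ attach x τ → σ ∈ splits (x ∷ w)
∈-splits-∷⁺ x w τ∈ σ∈ =
  subst (_ ∈_) (sym (splits-∷ x w)) (∈-concatMap⁺ (attach x) (lose τ∈ σ∈))

∈-splits-block⁺ : ∀ x w {u σ} → σ ∈ splits u → ((x ∷ w) ∷ σ) ∈ splits (x ∷ w ++ u)
∈-splits-block⁺ x []      {u} {σ} σ∈ = ∈-splits-∷⁺ x u σ∈ (singleton σ)
  where
  singleton : ∀ σ → ((x ∷ []) ∷ σ) ∈ attach x σ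
  singleton []      = here refl
  singleton (_ ∷ _) = here refl
∈-splits-block⁺ x (y ∷ w) {u} σ∈ =
  ∈-splits-∷⁺ x (y ∷ w ++ u) (∈-splits-block⁺ y w σ∈) (there (here refl))

∈-splits⁺ : ∀ {σ} → All NonEmpty σ → σ ∈ splits (concat σ)
∈-splits⁺ []                              = here refl
∈-splits⁺ (nonEmpty {x} {w} ∷ ne) = ∈-splits-block⁺ x w (∈-splits⁺ ne)

∈-splits⁻ : ∀ w {σ} → σ ∈ splits w → concat σ ≡ w × All NonEmpty σ
∈-splits⁻ []      (here refl) = refl , []
∈-splits⁻ (x ∷ w) σ∈ with find (∈-concatMap⁻ (attach x) (subst (_ ∈_) (splits-∷ x w) σ∈))
... | τ , τ∈ , σ∈′ with ∈-splits⁻ w τ∈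
...   | eq , ne = attached τ eq ne σ∈′
  where
  attached : ∀ τ {σ} → concat τ ≡ w → All NonEmpty τ → σ ∈ attach x τ →
             concat σ ≡ x ∷ w × All NonEmpty σ
  attached []      refl ne (here refl)             = refl , nonEmpty ∷ []
  attached (_ ∷ _) refl ne (here refl)             = refl , nonEmpty ∷ ne
  attached (_ ∷ _) refl (_ ∷ ne) (there (here refl)) = refl , nonEmpty ∷ ne

-- Left inverse of `attach x` on lists of nonempty blocks: a leading block of one letter was added
-- as a whole, a longer one received a letter.
detach : Cycles → Cycles
detach []                = []
detach ([] ∷ σ)          = σ
detach ((_ ∷ []) ∷ σ)    = σ
detach ((_ ∷ y ∷ w) ∷ σ) = (y ∷ w) ∷ σ

splits-unique : ∀ w → Unique (splits w)
splits-unique []      = [] ∷ []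
splits-unique (x ∷ w) rewrite splits-∷ x w =
  concatMap-unique (attach x) detach (splits-unique w)
    (All.tabulate (λ {τ} _ → attach-unique τ))
    (λ {τ} τ∈ → detach-attach τ (proj₂ (∈-splits⁻ w τ∈)))
  where
  attach-unique : ∀ τ → Unique (attach x τ)
  attach-unique []            = [] ∷ []
  -- With an empty leading block the two results share their first block and are told apart by the
  -- number of blocks.
  attach-unique ([] ∷ τ)      = ((λ eq → <⇒≢ (n<1+n _) (cong length (sym (∷-injectiveʳ eq)))) ∷ []) ∷ [] ∷ []
  attach-unique ((_ ∷ _) ∷ τ) = ((λ ()) ∷ []) ∷ [] ∷ []
  detach-attach : ∀ τ {σ} → All NonEmpty τ → σ ∈ attach x τ → detach σ ≡ τ
  detach-attach []      _              (here refl)         = refl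
  detach-attach (_ ∷ _) _              (here refl)         = refl
  detach-attach (_ ∷ _) (nonEmpty ∷ _) (there (here refl)) = refl

oneTo-unique : ∀ n → Unique (oneTo n)
oneTo-unique n = Unique.applyUpTo⁺₁ suc n (λ i<j _ eq → <⇒≢ i<j (suc-injective eq))

candidates-unique : ∀ n → Unique (candidates n)
candidates-unique n =
  concatMap-unique splits concat (wordsOver-unique (2 * n) (oneTo-unique n))
    (All.tabulate (λ {w} _ → splits-unique w)) (λ {w} _ σ∈ → proj₁ (∈-splits⁻ w σ∈))

∈-candidates⁺ : ∀ n σ → All NonEmpty σ → All (_∈ oneTo n) (concat σ) →
                length (concat σ) ≡ 2 * n → σ ∈ candidates n
∈-candidates⁺ n σ ne range len = ∈-concatMap⁺ splits (lose
  (subst (λ m → concat σ ∈ wordsOver (oneTo n) m) len (∈-wordsOver⁺ (concat σ) range))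
  (∈-splits⁺ ne))

∈-candidates⁻ : ∀ n {σ} → σ ∈ candidates n → All (_∈ oneTo n) (concat σ)
∈-candidates⁻ n {σ} σ∈ with find (∈-concatMap⁻ splits σ∈)
... | w , w∈ , σ∈′ with ∈-splits⁻ w σ∈′
...   | refl , _ = ∈-wordsOver⁻ (2 * n) w∈

-- Insertion and deletion of the maximal letter

data Insert (N : ℕ) : Word → Word → Set where
  here  : ∀ {x w}           → Insert N (x ∷ w) (x ∷ N ∷ N ∷ w)
  there : ∀ {x w v} → Insert N w v → Insert N (x ∷ w) (x ∷ v)

data Child (N : ℕ) : Cycles → Cycles → Set where
  new    : Child N [] ((N ∷ N ∷ []) ∷ [])
  inside : ∀ {c d σ} → Insert N c d → Child N (c ∷ σ) (d ∷ σ)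
  skip   : ∀ {c σ τ} → Child N σ τ → Child N (c ∷ σ) (c ∷ τ)

∈-insertions⁺ : ∀ {N w v} → Insert N w v → v ∈ insertions N w
∈-insertions⁺ here          = here refl
∈-insertions⁺ (there {x} i) = there (∈-map⁺ (x ∷_) (∈-insertions⁺ i))

∈-insertions⁻ : ∀ {N} w {v} → v ∈ insertions N w → Insert N w v
∈-insertions⁻ (x ∷ w) (here refl) = here
∈-insertions⁻ (x ∷ w) (there v∈) with ∈-map⁻ (x ∷_) v∈
... | _ , u∈ , refl = there (∈-insertions⁻ w u∈)

∈-children⁺ : ∀ {N σ τ} → Child N σ τ → τ ∈ children N σ
∈-children⁺     new                    = here refl
∈-children⁺     (inside {σ = σ} i)     = ∈-++⁺ˡ (∈-map⁺ (_∷ σ) (∈-insertions⁺ i))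
∈-children⁺ {N} (skip {c} {σ} {τ} ch)  =
  ∈-++⁺ʳ (map (_∷ σ) (insertions N c)) (∈-map⁺ (c ∷_) (∈-children⁺ ch))

∈-children⁻ : ∀ {N} σ {τ} → τ ∈ children N σ → Child N σ τ
∈-children⁻     []      (here refl) = new
∈-children⁻ {N} (c ∷ σ) τ∈ with ∈-++⁻ (map (_∷ σ) (insertions N c)) τ∈
... | inj₁ τ∈ˡ with ∈-map⁻ (_∷ σ) τ∈ˡ
...   | _ , d∈ , refl = inside (∈-insertions⁻ c d∈)
∈-children⁻ {N} (c ∷ σ) τ∈ | inj₂ τ∈ʳ with ∈-map⁻ (c ∷_) τ∈ʳ
...   | _ , υ∈ , refl = skip (∈-children⁻ σ υ∈)

Insert-↭ : ∀ {N w v} → Insert N w v → v ↭ N ∷ N ∷ w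
Insert-↭ {N} (here {x} {w})      = shifts (x ∷ []) (N ∷ N ∷ [])
Insert-↭ {N} (there {x} {w} {v} i) = ↭-trans (↭-prep x (Insert-↭ i)) (shifts (x ∷ []) (N ∷ N ∷ []))

Child-↭ : ∀ {N σ τ} → Child N σ τ → concat τ ↭ N ∷ N ∷ concat σ
Child-↭     new                  = ↭-refl
Child-↭     (inside {σ = σ} i)   = ++⁺ʳ (concat σ) (Insert-↭ i)
Child-↭ {N} (skip {c} ch)        = ↭-trans (++⁺ˡ c (Child-↭ ch)) (shifts c (N ∷ N ∷ []))

Insert-head : ∀ {N c d} → Insert N c d → head0 d ≡ head0 c
Insert-head here      = refl
Insert-head (there _) = refl

Insert-⊆ : ∀ {N w v} → Insert N w v → w ⊆ v
Insert-⊆ {N} here      = refl ∷ N ∷ʳ N ∷ʳ ⊆-refl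
Insert-⊆     (there i) = refl ∷ Insert-⊆ i

strip : ℕ → Word → Word
strip N = filter (λ x → ¬? (x ≟ N))

strip-id : ∀ {N w} → All (_< N) w → strip N w ≡ w
strip-id {N} = filter-all (λ x → ¬? (x ≟ N)) ∘ All.map <⇒≢

strip-NN : ∀ {N} w → strip N (N ∷ N ∷ w) ≡ strip N w
strip-NN {N} w = trans (filter-reject P? (λ n → n refl)) (filter-reject P? (λ n → n refl))
  where P? = λ x → ¬? (x ≟ N)

strip-Insert : ∀ {N w v} → Insert N w v → All (_< N) w → strip N v ≡ w
strip-Insert {N} (here {x} {w}) (x<N ∷ w<N) =
  trans (filter-accept (λ x → ¬? (x ≟ N)) (<⇒≢ x<N))
        (cong (x ∷_) (trans (strip-NN w) (strip-id w<N)))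
strip-Insert {N} (there {x} i) (x<N ∷ w<N) =
  trans (filter-accept (λ x → ¬? (x ≟ N)) (<⇒≢ x<N)) (cong (x ∷_) (strip-Insert i w<N))

occ-↭ : ∀ x {w v} → w ↭ v → occ x w ≡ occ x v
occ-↭ x p = ↭-length (filter-↭ (λ y → y ≟ x) p)

occ-≡ : ∀ x w → occ x (x ∷ w) ≡ suc (occ x w)
occ-≡ x w = cong length (filter-accept (λ y → y ≟ x) refl)

occ-≢ : ∀ {x y} w → y ≢ x → occ x (y ∷ w) ≡ occ x w
occ-≢ {x} w y≢x = cong length (filter-reject (λ y → y ≟ x) y≢x)

occ-∉ : ∀ {x} w → All (_≢ x) w → occ x w ≡ 0
occ-∉ {x} w w≢x = cong length (filter-none (λ y → y ≟ x) w≢x)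

occ≡0⇒≢ : ∀ {x} w → occ x w ≡ 0 → All (_≢ x) w
occ≡0⇒≢     []      _  = []
occ≡0⇒≢ {x} (y ∷ w) eq with y ≟ x
... | yes refl = contradiction (trans (sym (occ-≡ y w)) eq) λ ()
... | no  y≢x  = y≢x ∷ occ≡0⇒≢ w (trans (sym (occ-≢ w y≢x)) eq)

occ-++ : ∀ x w v → occ x (w ++ v) ≡ occ x w + occ x v
occ-++ x w v = trans (cong length (filter-++ (λ y → y ≟ x) w v)) (length-++ (filter (λ y → y ≟ x) w))

occ-NN-other : ∀ {x N} w → N ≢ x → occ x (N ∷ N ∷ w) ≡ occ x w
occ-NN-other w N≢x = trans (occ-≢ (_ ∷ w) N≢x) (occ-≢ w N≢x)

occ-NN-same : ∀ N w → occ N (N ∷ N ∷ w) ≡ 2 + occ N w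
occ-NN-same N w = trans (occ-≡ N (N ∷ w)) (cong suc (occ-≡ N w))

-- Stirling permutations of the second kind as predicates

Stirling : Word → Set
Stirling w = ∀ {x y} → x ∷ y ∷ x ∷ [] ⊆ w → x < y

data LeadingMin : Word → Set where
  leadingMin : ∀ {x w} → All (x ≤_) w → LeadingMin (x ∷ w)

-- `Stirling` speaks of subsequences, so deleting letters preserves it at once. It is imposed on `c`
-- itself; the equivalence with the condition on `red c` rests on ranks and is proved separately.
record StirlingCycle (c : Word) : Set where
  field
    twice    : All (λ x → occ x c ≡ 2) c
    leading  : LeadingMin c
    stirling : Stirling c

record IsStirling² (n : ℕ) (σ : Cycles) : Set where
  field
    cycles : All StirlingCycle σ
    heads  : Linked (λ c d → head0 c < head0 d) σ
    range  : All (λ x → 1 ≤ x × x ≤ n) (concat σ)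
    len    : length (concat σ) ≡ 2 * n
    each   : ∀ i → 1 ≤ i → i ≤ n → occ i (concat σ) ≡ 2

-- The two copies of `N` are adjacent and there is no third one, so no letter lies between copies of
-- `N`.
no-NyN : ∀ {N y w v} → Insert N w v → All (_< N) w → ¬ (N ∷ y ∷ N ∷ [] ⊆ v)
no-NyN {N} {y} (here {w = w}) (x<N ∷ w<N) (_ ∷ʳ s) = pair s
  where
  N∉ : ∀ {w} → All (_< N) w → ¬ (N ∷ [] ⊆ w)
  N∉ w<N s = <-irrefl refl (All.lookup w<N (to∈ s))
  pair : ¬ (N ∷ y ∷ N ∷ [] ⊆ N ∷ N ∷ w)
  pair (_ ∷ʳ _ ∷ʳ s)      = N∉ w<N (⊆-trans (refl ∷ minimum _) s)
  pair (_ ∷ʳ refl ∷ s)    = N∉ w<N (⊆-trans (_ ∷ʳ ⊆-refl) s)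
  pair (refl ∷ _ ∷ʳ s)    = N∉ w<N (⊆-trans (_ ∷ʳ ⊆-refl) s)
  pair (refl ∷ refl ∷ s)  = N∉ w<N s
no-NyN here (x<N ∷ w<N) (refl ∷ s) = contradiction x<N (<-irrefl refl)
no-NyN (there i) (x<N ∷ w<N) (_ ∷ʳ s) = no-NyN i w<N s
no-NyN (there i) (x<N ∷ w<N) (refl ∷ s) = contradiction x<N (<-irrefl refl)

-- In a pattern `x`, `y`, `x` of `v`, either `x` is `N`, which adjacency excludes; or only `y` is
-- `N`, which exceeds `x`; or removing every `N` moves the pattern into `w`.
Stirling-Insert : ∀ {N w v} → Insert N w v → All (_< N) w → Stirling w → Stirling v
Stirling-Insert {N} {w} {v} i w<N st {x} {y} s with x ≟ N | y ≟ N
... | yes refl | _        = contradiction s (no-NyN i w<N)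
... | no x≢N   | yes refl = below (All.lookup v≤N (to∈ (⊆-trans (refl ∷ minimum _) s)))
  where
  v≤N : All (_≤ N) v
  v≤N = All-resp-↭ (↭-sym (Insert-↭ i)) (≤-refl ∷ ≤-refl ∷ All.map <⇒≤ w<N)
  below : x ≤ N → x < N
  below x≤N = ≤∧≢⇒< x≤N x≢N
... | no x≢N   | no y≢N   = st (subst₂ _⊆_ stripped (strip-Insert i w<N) (⊆.filter⁺ P? P? (λ { refl p → p }) s))
  where
  P? = λ x → ¬? (x ≟ N)
  stripped : strip N (x ∷ y ∷ x ∷ []) ≡ x ∷ y ∷ x ∷ []
  stripped = filter-all P? (x≢N ∷ y≢N ∷ x≢N ∷ [])

occ-Insert : ∀ {N w v} → Insert N w v → ∀ x → occ x v ≡ occ x (N ∷ N ∷ w)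
occ-Insert i x = occ-↭ x (Insert-↭ i)

StirlingCycle-NN : ∀ N → StirlingCycle (N ∷ N ∷ [])
StirlingCycle-NN N = record
  { twice    = occ-NN-same N [] ∷ occ-NN-same N [] ∷ []
  ; leading  = leadingMin (≤-refl ∷ [])
  ; stirling = λ s → contradiction (length-mono-≤ s) λ { (s≤s (s≤s ())) }
  }

StirlingCycle-Insert : ∀ {N w v} → Insert N w v → All (_< N) w →
                       StirlingCycle w → StirlingCycle v
StirlingCycle-Insert {N} {w} {v} i w<N c = record
  { twice    = All-resp-↭ (↭-sym (Insert-↭ i)) (occ-N ∷ occ-N ∷ All.map occ-w (All.zip (w<N , twice)))
  ; leading  = leading⁺ i w<N leading
  ; stirling = Stirling-Insert i w<N stirling
  }
  where
  open StirlingCycle c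
  occ-N : occ N v ≡ 2
  occ-N = trans (occ-Insert i N)
    (trans (occ-NN-same N w) (cong (2 +_) (occ-∉ w (All.map <⇒≢ w<N))))
  occ-w : ∀ {x} → x < N × occ x w ≡ 2 → occ x v ≡ 2
  occ-w {x} (x<N , eq) = trans (occ-Insert i x) (trans (occ-NN-other w (>⇒≢ x<N)) eq)
  leading⁺ : ∀ {w v} → Insert N w v → All (_< N) w → LeadingMin w → LeadingMin v
  leading⁺ here      (x<N ∷ _) (leadingMin x≤w) = leadingMin (<⇒≤ x<N ∷ <⇒≤ x<N ∷ x≤w)
  leading⁺ (there i) (x<N ∷ _) (leadingMin x≤w) =
    leadingMin (All-resp-↭ (↭-sym (Insert-↭ i)) (<⇒≤ x<N ∷ <⇒≤ x<N ∷ x≤w))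

StirlingCycle-uninsert : ∀ {N w v} → Insert N w v → All (_< N) w →
                         StirlingCycle v → StirlingCycle w
StirlingCycle-uninsert {N} {w} {v} i w<N c with All-resp-↭ (Insert-↭ i) (StirlingCycle.twice c)
... | _ ∷ _ ∷ twice-w = record
  { twice    = All.map occ-w (All.zip (w<N , twice-w))
  ; leading  = leading⁻ i leading
  ; stirling = λ s → stirling (⊆-trans s (Insert-⊆ i))
  }
  where
  open StirlingCycle c
  occ-w : ∀ {x} → x < N × occ x v ≡ 2 → occ x w ≡ 2
  occ-w {x} (x<N , eq) = trans (sym (occ-NN-other w (>⇒≢ x<N))) (trans (sym (occ-Insert i x)) eq)
  leading⁻ : ∀ {w v} → Insert N w v → LeadingMin v → LeadingMin w
  leading⁻ here      (leadingMin (_ ∷ _ ∷ x≤w)) = leadingMin x≤w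
  leading⁻ (there i) (leadingMin x≤v) with All-resp-↭ (Insert-↭ i) x≤v
  ... | _ ∷ _ ∷ x≤w = leadingMin x≤w

leading⇒nonEmpty : ∀ {c} → StirlingCycle c → NonEmpty c
leading⇒nonEmpty c with StirlingCycle.leading c
... | leadingMin _ = nonEmpty

nonEmpties : ∀ {σ} → All StirlingCycle σ → All NonEmpty σ
nonEmpties = All.map leading⇒nonEmpty

Increasing : Cycles → Set
Increasing = Linked (λ c d → head0 c < head0 d)

increasing-∷ : ∀ {c d σ} → head0 d ≡ head0 c → Increasing (c ∷ σ) → Increasing (d ∷ σ)
increasing-∷         eq [-]      = [-]
increasing-∷ {c} {d} eq (lt ∷ l) = subst (_< _) (sym eq) lt ∷ l

increasing-Child : ∀ {N σ τ} → Child N σ τ → All NonEmpty σ → All (All (_< N)) σ →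
                   Increasing σ → Increasing τ
increasing-Child new        _  _   l = [-]
increasing-Child (inside i) _  _   l = increasing-∷ (Insert-head i) l
increasing-Child (skip new) (nonEmpty ∷ _) ((x<N ∷ _) ∷ _) l = x<N ∷ [-]
increasing-Child (skip (inside i)) _ _ (lt ∷ l) =
  subst (_ <_) (sym (Insert-head i)) lt ∷ increasing-∷ (Insert-head i) l
increasing-Child (skip ch@(skip _)) (_ ∷ ne) (_ ∷ σ<N) (lt ∷ l) =
  lt ∷ increasing-Child ch ne σ<N l

increasing-unchild : ∀ {N σ τ} → Child N σ τ → Increasing τ → Increasing σ
increasing-unchild new               l = []
increasing-unchild (inside i)        l = increasing-∷ (sym (Insert-head i)) l
increasing-unchild (skip new)        l = [-]
increasing-unchild (skip (inside i)) (lt ∷ l) =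
  subst (_ <_) (Insert-head i) lt ∷ increasing-∷ (sym (Insert-head i)) l
increasing-unchild (skip ch@(skip _)) (lt ∷ l) = lt ∷ increasing-unchild ch l

cycles-Child : ∀ {N σ τ} → Child N σ τ → All (All (_< N)) σ →
               All StirlingCycle σ → All StirlingCycle τ
cycles-Child {N} new    _           _        = StirlingCycle-NN N ∷ []
cycles-Child (inside i) (c<N ∷ _)   (c ∷ cs) = StirlingCycle-Insert i c<N c ∷ cs
cycles-Child (skip ch)  (_ ∷ σ<N)   (c ∷ cs) = c ∷ cycles-Child ch σ<N cs

cycles-unchild : ∀ {N σ τ} → Child N σ τ → All (All (_< N)) σ →
                 All StirlingCycle τ → All StirlingCycle σ
cycles-unchild new        _         _        = []
cycles-unchild (inside i) (c<N ∷ _) (c ∷ cs) = StirlingCycle-uninsert i c<N c ∷ cs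
cycles-unchild (skip ch)  (_ ∷ σ<N) (c ∷ cs) = c ∷ cycles-unchild ch σ<N cs

below-suc : ∀ {n σ} → All (λ x → 1 ≤ x × x ≤ n) (concat σ) → All (All (_< suc n)) σ
below-suc = All.concat⁻ ∘ All.map (s≤s ∘ proj₂)

2*suc : ∀ n → 2 * suc n ≡ 2 + 2 * n
2*suc = *-suc 2

IsStirling²-Child : ∀ {n σ τ} → Child (suc n) σ τ → IsStirling² n σ → IsStirling² (suc n) τ
IsStirling²-Child {n} {σ} {τ} ch st = record
  { cycles = cycles-Child ch σ≤n cycles
  ; heads  = increasing-Child ch (nonEmpties cycles) σ≤n heads
  ; range  = All-resp-↭ (↭-sym (Child-↭ ch))
               ((s≤s z≤n , ≤-refl) ∷ (s≤s z≤n , ≤-refl) ∷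
                All.map (λ (l , u) → l , m≤n⇒m≤1+n u) range)
  ; len    = trans (↭-length (Child-↭ ch)) (trans (cong (2 +_) len) (sym (2*suc n)))
  ; each   = each′
  }
  where
  open IsStirling² st
  σ≤n = below-suc range
  each′ : ∀ i → 1 ≤ i → i ≤ suc n → occ i (concat τ) ≡ 2
  each′ i 1≤i i≤1+n with suc n ≟ i
  ... | yes refl = trans (occ-↭ (suc n) (Child-↭ ch)) (trans (occ-NN-same (suc n) (concat σ))
          (cong (2 +_) (occ-∉ (concat σ) (All.map (λ (_ , u) → <⇒≢ (s≤s u)) range))))
  ... | no  n≢i  = trans (occ-↭ i (Child-↭ ch)) (trans (occ-NN-other (concat σ) n≢i)
          (each i 1≤i (s≤s⁻¹ (≤∧≢⇒< i≤1+n (n≢i ∘ sym)))))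

IsStirling²-unchild : ∀ {n σ τ} → Child (suc n) σ τ → IsStirling² (suc n) τ → IsStirling² n σ
IsStirling²-unchild {n} {σ} {τ} ch st = record
  { cycles = cycles-unchild ch (below-suc range-σ) cycles
  ; heads  = increasing-unchild ch heads
  ; range  = range-σ
  ; len    = suc-injective (suc-injective (trans (sym (↭-length (Child-↭ ch))) (trans len (2*suc n))))
  ; each   = λ i 1≤i i≤n → trans (sym (trans (occ-↭ i (Child-↭ ch)) (occ-NN-other (concat σ) (>⇒≢ (s≤s i≤n)))))
                             (each i 1≤i (m≤n⇒m≤1+n i≤n))
  }
  where
  open IsStirling² st
  max∉σ : All (_≢ suc n) (concat σ)
  max∉σ = occ≡0⇒≢ (concat σ) (suc-injective (suc-injective (trans
    (sym (trans (occ-↭ (suc n) (Child-↭ ch)) (occ-NN-same (suc n) (concat σ))))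
    (each (suc n) (s≤s z≤n) ≤-refl))))
  range-σ : All (λ x → 1 ≤ x × x ≤ n) (concat σ)
  range-σ with All-resp-↭ (Child-↭ ch) range
  ... | _ ∷ _ ∷ r = All.map (λ ((l , u) , x≢) → l , s≤s⁻¹ (≤∧≢⇒< u x≢)) (All.zip (r , max∉σ))

-- The Stirling condition forces the two copies of the maximum to be adjacent.
Insert-exists : ∀ {N} x w → All (_≤ N) w → Stirling (x ∷ w) → occ N w ≡ 2 →
                ∃ λ v → Insert N v (x ∷ w)
Insert-exists {N} x (y ∷ w) (y≤N ∷ w≤N) st eq with y ≟ N
... | no y≢N with Insert-exists y w w≤N (λ s → st (x ∷ʳ s)) (trans (sym (occ-≢ w y≢N)) eq)
...   | v , i = x ∷ v , there i
Insert-exists {N} x (y ∷ []) _ st eq | yes refl =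
  contradiction (trans (sym (occ-≡ N [])) eq) λ ()
Insert-exists {N} x (y ∷ z ∷ w) (y≤N ∷ z≤N ∷ w≤N) st eq | yes refl with z ≟ N | N ∈? w
... | yes refl | _       = x ∷ w , here
... | no  z≢N  | yes N∈w = contradiction z≤N (<⇒≱ (st (x ∷ʳ refl ∷ refl ∷ from∈ N∈w)))
... | no  z≢N  | no  N∉w = contradiction
  (trans (sym (trans (occ-≡ N (z ∷ w)) (cong suc (trans (occ-≢ w z≢N)
    (occ-∉ w (All.¬Any⇒All¬ w (N∉w ∘ Any.map sym))))))) eq) λ ()

-- Serves a cycle headed by the maximum `N`: its head is also its minimum, so all letters agree, and
-- a single further copy is left for the tail.
constant-cycle : ∀ {N} w → All (N ≤_) w → All (_≤ N) w → occ N w ≡ 1 → w ≡ N ∷ []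
constant-cycle {N} (y ∷ w) (N≤y ∷ N≤w) (y≤N ∷ w≤N) eq with ≤-antisym N≤y y≤N
constant-cycle {N} (y ∷ [])    _                 _           eq | refl = refl
constant-cycle {N} (y ∷ z ∷ w) (_ ∷ N≤z ∷ _) (_ ∷ z≤N ∷ _) eq | refl with ≤-antisym N≤z z≤N
... | refl = contradiction (trans (sym (occ-NN-same N w)) eq) λ ()

-- If `N` is not the head, its copies are adjacent behind some letter and can be deleted. If it is
-- the head, the cycle is `N ∷ N ∷ []`, and no cycle follows, because later heads would exceed `N`.
parent-here : ∀ {N c τ} → LeadingMin c → N ∈ c → All StirlingCycle (c ∷ τ) →
              Increasing (c ∷ τ) → All (All (_≤ N)) (c ∷ τ) → ∃ λ σ → Child N σ (c ∷ τ)
parent-here {N} {x ∷ w} {τ} (leadingMin x≤w) N∈c (sc ∷ scs) inc ((_ ∷ w≤N) ∷ τ≤N) with x ≟ N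
... | no x≢N =
  let v , i = Insert-exists x w w≤N stirling (trans (sym (occ-≢ w x≢N)) (All.lookup twice N∈c))
  in v ∷ τ , inside i
  where open StirlingCycle sc
... | yes refl with constant-cycle w x≤w w≤N
                      (suc-injective (trans (sym (occ-≡ N w)) (All.lookup (StirlingCycle.twice sc) N∈c)))
...   | refl = last scs inc τ≤N
  where
  last : ∀ {τ} → All StirlingCycle τ → Increasing ((N ∷ N ∷ []) ∷ τ) → All (All (_≤ N)) τ →
         ∃ λ σ → Child N σ ((N ∷ N ∷ []) ∷ τ)
  last []        _         _         = [] , new
  last (sd ∷ _) (N<d ∷ _) (d≤N ∷ _) with leading⇒nonEmpty sd | d≤N
  ... | nonEmpty | y≤N ∷ _ = contradiction y≤N (<⇒≱ N<d)

parent : ∀ {N} τ → All StirlingCycle τ → Increasing τ → All (All (_≤ N)) τ →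
         occ N (concat τ) ≡ 2 → ∃ λ σ → Child N σ τ
parent {N} (c ∷ τ) (sc ∷ scs) inc (c≤N ∷ τ≤N) eq with N ∈? c
... | yes N∈c = parent-here (StirlingCycle.leading sc) N∈c (sc ∷ scs) inc (c≤N ∷ τ≤N)
... | no  N∉c =
  let σ , ch = parent τ scs (Linked.tail inc) τ≤N (trans
                 (cong (_+ occ N (concat τ)) (sym (occ-∉ c N≢c)))
                 (trans (sym (occ-++ N c (concat τ))) eq))
  in c ∷ σ , skip ch
  where
  N≢c : All (_≢ N) c
  N≢c = All.¬Any⇒All¬ c (N∉c ∘ Any.map sym)

-- Insertion produces every Stirling permutation of the second kind exactly once

generated-sound : ∀ n {σ} → σ ∈ generated n → IsStirling² n σ
generated-sound zero    (here refl) = record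
  { cycles = [] ; heads = [] ; range = [] ; len = refl
  ; each = λ i 1≤i i≤0 → contradiction (≤-trans 1≤i i≤0) λ () }
generated-sound (suc n) τ∈ with find (∈-concatMap⁻ (children (suc n)) τ∈)
... | σ , σ∈ , τ∈′ = IsStirling²-Child (∈-children⁻ σ τ∈′) (generated-sound n σ∈)

generated-complete : ∀ n {σ} → IsStirling² n σ → σ ∈ generated n
generated-complete zero {[]}    st = here refl
generated-complete zero {c ∷ σ} st with IsStirling².cycles st
... | sc ∷ _ with leading⇒nonEmpty sc | IsStirling².len st
...   | nonEmpty | ()
generated-complete (suc n) {τ} st =
  let open IsStirling² st
      σ , ch = parent τ cycles heads (All.concat⁻ (All.map proj₂ range)) (each (suc n) (s≤s z≤n) ≤-refl)
  in ∈-concatMap⁺ (children (suc n))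
       (lose (generated-complete n (IsStirling²-unchild ch st)) (∈-children⁺ ch))

Bounded : ℕ → Cycles → Set
Bounded n σ = All (All (_< suc n)) σ × length (concat σ) ≡ 2 * n

generated-bounded : ∀ n → All (Bounded n) (generated n)
generated-bounded n = All.tabulate λ σ∈ →
  let open IsStirling² (generated-sound n σ∈) in below-suc range , len

-- An insertion into `w` keeps its head, which is below `N`. This separates a pair placed directly
-- in front of `w` from one placed inside.
¬Insert-front : ∀ {N w} → All (_< N) w → ¬ Insert N w (N ∷ N ∷ w)
¬Insert-front (x<N ∷ _) i with Insert-head i
... | refl = <-irrefl refl x<N

insertions-unique : ∀ {N} w → All (_< N) w → Unique (insertions N w)
insertions-unique []      _           = []
insertions-unique {N} (x ∷ w) (_ ∷ w<N) = Unique.map⁺ ∷-injectiveʳ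
  (All.tabulate (λ { v∈ refl → ¬Insert-front w<N (∈-insertions⁻ w v∈) }) ∷ insertions-unique w w<N)

children-unique : ∀ {N} σ → All (All (_< N)) σ → Unique (children N σ)
children-unique     []      []           = [] ∷ []
children-unique {N} (c ∷ σ) (c<N ∷ σ<N) = Unique.++⁺
  (Unique.map⁺ ∷-injectiveˡ (insertions-unique c c<N))
  (Unique.map⁺ ∷-injectiveʳ (children-unique σ σ<N)) disjoint
  where
  disjoint : ∀ {τ} → ¬ (τ ∈ map (_∷ σ) (insertions N c) × τ ∈ map (c ∷_) (children N σ))
  disjoint (∈₁ , ∈₂) with ∈-map⁻ (_∷ σ) ∈₁ | ∈-map⁻ (c ∷_) ∈₂
  ... | _ , d∈ , refl | _ , _ , eq with ∷-injectiveˡ eq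
  ...   | refl = contradiction (↭-length (Insert-↭ (∈-insertions⁻ c d∈))) (<⇒≢ (m<n+m _ (s≤s z≤n)))

prepend : Word → Cycles → Cycles
prepend []      σ = σ
prepend (x ∷ w) σ = (x ∷ w) ∷ σ

-- Left inverse of `Child`: `prepend` drops a cycle that has become empty, so a final `N ∷ N ∷ []`
-- disappears altogether.
erase : ℕ → Cycles → Cycles
erase N []      = []
erase N (c ∷ σ) = prepend (strip N c) (erase N σ)

prepend-nonEmpty : ∀ {c σ} → NonEmpty c → prepend c σ ≡ c ∷ σ
prepend-nonEmpty nonEmpty = refl

erase-id : ∀ {N σ} → All NonEmpty σ → All (All (_< N)) σ → erase N σ ≡ σ
erase-id []        []          = refl
erase-id (ne ∷ nes) (c<N ∷ σ<N) =
  trans (cong₂ prepend (strip-id c<N) (erase-id nes σ<N)) (prepend-nonEmpty ne)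

erase-Child : ∀ {N σ τ} → Child N σ τ → All NonEmpty σ → All (All (_< N)) σ → erase N τ ≡ σ
erase-Child {N} new    _          _           = cong (λ w → prepend w []) (strip-NN {N} [])
erase-Child (inside i) (ne ∷ nes) (c<N ∷ σ<N) =
  trans (cong₂ prepend (strip-Insert i c<N) (erase-id nes σ<N)) (prepend-nonEmpty ne)
erase-Child (skip ch)  (ne ∷ nes) (c<N ∷ σ<N) =
  trans (cong₂ prepend (strip-id c<N) (erase-Child ch nes σ<N)) (prepend-nonEmpty ne)

generated-unique : ∀ n → Unique (generated n)
generated-unique zero    = [] ∷ []
generated-unique (suc n) =
  concatMap-unique (children (suc n)) (erase (suc n)) (generated-unique n)
    (All.map (λ {σ} (σ≤n , _) → children-unique σ σ≤n) (generated-bounded n))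
    (λ {σ} σ∈ τ∈ → let open IsStirling² (generated-sound n σ∈) in
      erase-Child (∈-children⁻ σ τ∈) (nonEmpties cycles) (below-suc range))

-- The recurrence for the counts

∑-+ : {A : Set} (f g : A → ℕ) (xs : List A) → ∑ xs (λ x → f x + g x) ≡ ∑ xs f + ∑ xs g
∑-+ f g []       = refl
∑-+ f g (x ∷ xs) = trans (cong (λ t → f x + g x + t) (∑-+ f g xs)) (interchange (f x) (g x) _ _)
  where
  interchange : ∀ a b c d → a + b + (c + d) ≡ a + c + (b + d)
  interchange = solve-∀

∑-* : {A : Set} (k : ℕ) (f : A → ℕ) (xs : List A) → ∑ xs (λ x → k * f x) ≡ k * ∑ xs f
∑-* k f []       = sym (*-zeroʳ k)
∑-* k f (x ∷ xs) = trans (cong (λ t → k * f x + t) (∑-* k f xs)) (sym (*-distribˡ-+ k (f x) _))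

δ : (i j f a c g : ℕ) → ℕ
δ i j f a c g = ⟦ (a ≡ᵇ i) ∧ (c ≡ᵇ j) ∧ (g ≡ᵇ f) ⟧

-- On the support of the indicator the statistic equals the index. Coefficients depending on σ
-- thereby become constants, which can be taken out of the sum over σ.
δ-cap : ∀ i j f a c g → a * δ i j f a c g ≡ i * δ i j f a c g
δ-cap i j f a c g with a ≡ᵇ i in eq
... | false = trans (*-zeroʳ a) (sym (*-zeroʳ i))
... | true  = cong (_* ⟦ (c ≡ᵇ j) ∧ (g ≡ᵇ f) ⟧) (≡ᵇ⇒≡ a i (Equivalence.from T-≡ eq))

δ-fix : ∀ i j f a c g → g * δ i j f a c g ≡ f * δ i j f a c g
δ-fix i j f a c g with g ≡ᵇ f in eq
... | true  = cong (_* ⟦ (a ≡ᵇ i) ∧ (c ≡ᵇ j) ∧ true ⟧) (≡ᵇ⇒≡ g f (Equivalence.from T-≡ eq))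
... | false rewrite ∧-zeroʳ (c ≡ᵇ j) | ∧-zeroʳ (a ≡ᵇ i) = trans (*-zeroʳ g) (sym (*-zeroʳ f))

-- Replacing `pred g` by `g` moves the index to `suc f`; for `g` equal to `zero`, the factor on the
-- left and the indicator on the right both vanish.
δ-pred-fix : ∀ i j f a c g → g * δ i j f a c (pred g) ≡ suc f * δ i j (suc f) a c g
δ-pred-fix i j f a c (suc g) = δ-fix i j (suc f) a c (suc g)
δ-pred-fix i j f a c zero
  rewrite ∧-zeroʳ (c ≡ᵇ j) | ∧-zeroʳ (a ≡ᵇ i) = sym (*-zeroʳ f)

-- On coefficients, multiplication by x, by q, and by qy, where y marks fixed points.
shiftˣ shift^q shift^qf : (ℕ → ℕ → ℕ → ℕ) → ℕ → ℕ → ℕ → ℕ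
shiftˣ h zero    j f = 0
shiftˣ h (suc i) j f = h i j f
shift^q h i zero    f = 0
shift^q h i (suc j) f = h i j f
shift^qf h i j zero    = 0
shift^qf h i j (suc f) = shift^q h i j f

count : ℕ → ℕ → ℕ → ℕ → ℕ
count n i j f = ∑ (generated n) (statistic (δ i j f))

ChildrenCount : ℕ → Cycles → (i j f : ℕ) → Set
ChildrenCount n σ i j f =
  ∑ (children (suc n) σ) (statistic (δ i j f))
    + (2 * i + 2 * f) * shiftˣ (λ i j f → statistic (δ i j f) σ) i j f
  ≡ 2 * i * statistic (δ i j f) σ
    + (2 + 2 * n) * shiftˣ (λ i j f → statistic (δ i j f) σ) i j f
    + 2 * suc f * shiftˣ (λ i j f → statistic (δ i j f) σ) i j (suc f)
    + shift^qf (λ i j f → statistic (δ i j f) σ) i j f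

children-count : ∀ n σ → Bounded n σ → ∀ i j f → ChildrenCount n σ i j f
children-count n σ (σ≤n , len) i j f = go i
  where
  a = cap σ
  c = cyc σ
  g = fix σ
  W : ∀ i j f → δ i j f a (suc c) (suc g) ≡ shift^qf (λ i j f → δ i j f a c g) i j f
  W i j       zero    = cong ⟦_⟧ (trans (cong ((a ≡ᵇ i) ∧_) (∧-zeroʳ (suc c ≡ᵇ j))) (∧-zeroʳ (a ≡ᵇ i)))
  W i zero    (suc f) = cong ⟦_⟧ (∧-zeroʳ (a ≡ᵇ i))
  W i (suc j) (suc f) = refl
  scale : ∀ x y d e → x * d ≡ y * e → 2 * x * d ≡ 2 * y * e
  scale x y d e eq = trans (*-assoc 2 x d) (trans (cong (2 *_) eq) (sym (*-assoc 2 y e)))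
  go : ∀ i → ChildrenCount n σ i j f
  -- A child without plateaux cannot have gained one, so every indicator at `suc a` computes to 0.
  go zero = begin
    C + (2 * f) * 0
      ≡⟨ cong (C +_) (trans (*-zeroʳ (2 * f)) (sym (*-zeroʳ (2 * a + 2 * g)))) ⟩
    C + (2 * a + 2 * g) * 0                 ≡⟨ children-sum σ σ≤n (δ 0 j f) ⟩
    2 * a * D + L * 0 + 2 * g * 0 + δ 0 j f a (suc c) (suc g)
      ≡⟨ cong₂ _+_ (cong₂ _+_ (cong₂ _+_ (scale a 0 D D (δ-cap 0 j f a c g))
                           (trans (*-zeroʳ L) (sym (*-zeroʳ (2 + 2 * n)))))
                      (trans (*-zeroʳ (2 * g)) (sym (*-zeroʳ (2 * suc f))))) (W 0 j f) ⟩
    _ ∎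
    where
    open ≡-Reasoning
    C = ∑ (children (suc n) σ) (statistic (δ 0 j f))
    D = δ 0 j f a c g
    L = length (concat σ)
  -- A parent counted by `X` has `i` plateaux, one less than the index `suc i` of the claim. The
  -- surplus `2 * X` is what raises the length `2 * n` to `2 + 2 * n`.
  go (suc i) = begin
    C + (2 * suc i + 2 * f) * X               ≡⟨ lhs C i f X ⟩
    C + (2 * (i * X) + 2 * (f * X)) + 2 * X
      ≡⟨ cong (λ t → C + t + 2 * X) (cong₂ (λ s t → 2 * s + 2 * t) (δ-cap i j f a c g) (δ-fix i j f a c g)) ⟨
    C + (2 * (a * X) + 2 * (g * X)) + 2 * X   ≡⟨ cong (_+ 2 * X) (mid C a g X) ⟩
    C + (2 * a + 2 * g) * X + 2 * X           ≡⟨ cong (_+ 2 * X) (children-sum σ σ≤n (δ (suc i) j f)) ⟩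
    2 * a * D + length (concat σ) * X + 2 * g * δ i j f a c (pred g) + δ (suc i) j f a (suc c) (suc g) + 2 * X
      ≡⟨ cong (_+ 2 * X) (cong₂ _+_ (cong₂ _+_ (cong₂ _+_
            (scale a (suc i) D D (δ-cap (suc i) j f a c g)) (cong (_* X) len))
            (scale g (suc f) _ Z (δ-pred-fix i j f a c g))) (W (suc i) j f)) ⟩
    2 * suc i * D + 2 * n * X + 2 * suc f * Z + V + 2 * X ≡⟨ rhs (2 * suc i * D) n X (2 * suc f * Z) V ⟩
    2 * suc i * D + (2 + 2 * n) * X + 2 * suc f * Z + V ∎
    where
    open ≡-Reasoning
    C = ∑ (children (suc n) σ) (statistic (δ (suc i) j f))
    D = δ (suc i) j f a c g
    X = δ i j f a c g
    Z = δ i j (suc f) a c g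
    V = shift^qf (λ i j f → δ i j f a c g) (suc i) j f
    lhs : ∀ C i f X → C + (2 * suc i + 2 * f) * X ≡ C + (2 * (i * X) + 2 * (f * X)) + 2 * X
    lhs = solve-∀
    mid : ∀ C a g X → C + (2 * (a * X) + 2 * (g * X)) ≡ C + (2 * a + 2 * g) * X
    mid = solve-∀
    rhs : ∀ D n X Z V → D + 2 * n * X + Z + V + 2 * X ≡ D + (2 + 2 * n) * X + Z + V
    rhs = solve-∀

∑-0 : {A : Set} (xs : List A) → ∑ xs (λ _ → 0) ≡ 0
∑-0 []       = refl
∑-0 (x ∷ xs) = ∑-0 xs

-- This is the coefficient form of the equation for F_{n+1}, obtained by summing `children-count`
-- over the parents. The terms with a minus sign stand on the left; there x² ∂/∂x would carry the
-- factor i - 1, and using i instead is compensated by `2 + 2 * n`.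
count-recurrence : ∀ n i j f →
  count (suc n) i j f + (2 * i + 2 * f) * shiftˣ (count n) i j f
  ≡ 2 * i * count n i j f + (2 + 2 * n) * shiftˣ (count n) i j f
    + 2 * suc f * shiftˣ (count n) i j (suc f) + shift^qf (count n) i j f
count-recurrence n i j f = begin
  count (suc n) i j f + k₁ * shiftˣ (count n) i j f
    ≡⟨ cong₂ _+_ (∑-concatMap (children (suc n)) (statistic (δ i j f)) G) (cong (k₁ *_) (shiftˣ-∑ i f)) ⟩
  ∑ G C + k₁ * ∑ G (X f)
    ≡⟨ cong (∑ G C +_) (∑-* k₁ (X f) G) ⟨
  ∑ G C + ∑ G (λ σ → k₁ * X f σ)
    ≡⟨ ∑-+ C (λ σ → k₁ * X f σ) G ⟨
  ∑ G (λ σ → C σ + k₁ * X f σ)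
    ≡⟨ ∑-cong (All.map (λ {σ} b → children-count n σ b i j f) (generated-bounded n)) ⟩
  ∑ G (λ σ → k₂ * D σ + k₃ * X f σ + k₄ * X (suc f) σ + V σ)
    ≡⟨ ∑-+ (λ σ → k₂ * D σ + k₃ * X f σ + k₄ * X (suc f) σ) V G ⟩
  ∑ G (λ σ → k₂ * D σ + k₃ * X f σ + k₄ * X (suc f) σ) + ∑ G V
    ≡⟨ cong₂ _+_ (trans (∑-+ (λ σ → k₂ * D σ + k₃ * X f σ) (λ σ → k₄ * X (suc f) σ) G)
        (cong₂ _+_ (trans (∑-+ (λ σ → k₂ * D σ) (λ σ → k₃ * X f σ) G)
          (cong₂ _+_ (∑-* k₂ D G) (trans (∑-* k₃ (X f) G) (cong (k₃ *_) (sym (shiftˣ-∑ i f))))))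
          (trans (∑-* k₄ (X (suc f)) G) (cong (k₄ *_) (sym (shiftˣ-∑ i (suc f)))))))
        (sym (shift^qf-∑ j f)) ⟩
  _ ∎
  where
  open ≡-Reasoning
  G = generated n
  k₁ = 2 * i + 2 * f
  k₂ = 2 * i
  k₃ = 2 + 2 * n
  k₄ = 2 * suc f
  C D V : Cycles → ℕ
  C σ = ∑ (children (suc n) σ) (statistic (δ i j f))
  D σ = statistic (δ i j f) σ
  V σ = shift^qf (λ i j f → statistic (δ i j f) σ) i j f
  X : ℕ → Cycles → ℕ
  X f σ = shiftˣ (λ i j f → statistic (δ i j f) σ) i j f
  shiftˣ-∑ : ∀ i f → shiftˣ (count n) i j f ≡ ∑ G (λ σ → shiftˣ (λ i j f → statistic (δ i j f) σ) i j f)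
  shiftˣ-∑ zero    f = sym (∑-0 G)
  shiftˣ-∑ (suc i) f = refl
  shift^qf-∑ : ∀ j f → shift^qf (count n) i j f ≡
                     ∑ G (λ σ → shift^qf (λ i j f → statistic (δ i j f) σ) i j f)
  shift^qf-∑ zero    zero    = sym (∑-0 G)
  shift^qf-∑ (suc _) zero    = sym (∑-0 G)
  shift^qf-∑ zero    (suc f) = sym (∑-0 G)
  shift^qf-∑ (suc j) (suc f) = refl

-- When the equation for F_{n+2} is differentiated in y, the factor 1-y contributes -2x ∂F_{n+1}/∂y,
-- which lowers 2(n+1)x to 2nx. By induction the outcome is (n+1)q times the equation for F_{n+1},
-- plus the q F_{n+1} coming from qy: together (n+2) q F_{n+1}.
marked-fixed-point : ∀ n i j f →
  suc f * count (suc n) i j (suc f) ≡ suc n * shift^q (count n) i j f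
marked-fixed-point zero (suc i) zero    f       = *-zeroʳ f
marked-fixed-point zero (suc i) (suc j) f       = *-zeroʳ f
marked-fixed-point zero zero    zero    f       = *-zeroʳ f
marked-fixed-point zero zero (suc zero) zero    = refl
marked-fixed-point zero zero (suc zero) (suc f) = *-zeroʳ f
marked-fixed-point zero zero (suc (suc j)) f    = *-zeroʳ f
marked-fixed-point (suc n) i j f = +-cancelʳ-≡ K _ _ (begin
  suc f * a + K
    ≡⟨ lhs f a i m qx qy qx′ n (f * u) ⟩
  suc f * a + (2 * i + 2 * suc f) * (m * qx)
    + (m * (2 * i * qy + (2 + 2 * n) * qx + 2 * suc f * qx′) + f * u)
    ≡⟨ cong₂ (λ s t → suc f * a + (2 * i + 2 * suc f) * s
                    + (m * (2 * i * qy + (2 + 2 * n) * qx + 2 * suc f * qx′) + t))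
         (sym (ihˣ i f)) (ih-u j f) ⟩
  suc f * a + (2 * i + 2 * suc f) * (suc f * x₁)
    + (m * (2 * i * qy + (2 + 2 * n) * qx + 2 * suc f * qx′) + m * w)
    ≡⟨ factor f a i x₁ m _ w ⟩
  suc f * (a + (2 * i + 2 * suc f) * x₁)
    + m * (2 * i * qy + (2 + 2 * n) * qx + 2 * suc f * qx′ + w)
    ≡⟨ cong₂ (λ s t → suc f * s + m * t) (count-recurrence (suc n) i j (suc f)) (sym (rec-u j)) ⟩
  suc f * (2 * i * y₁ + (2 + 2 * suc n) * x₁ + 2 * suc (suc f) * x₂ + u)
    + m * (u + (2 * i + 2 * f) * qx)
    ≡⟨ expand f i y₁ n x₁ x₂ u _ ⟩
  2 * i * (suc f * y₁) + (2 + 2 * suc n) * (suc f * x₁) + 2 * suc f * (suc (suc f) * x₂) + suc f * u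
    + m * (u + (2 * i + 2 * f) * qx)
    ≡⟨ cong (λ t → t + suc f * u + m * (u + (2 * i + 2 * f) * qx))
         (cong₂ _+_ (cong₂ (λ s t → 2 * i * s + (2 + 2 * suc n) * t) (marked-fixed-point n i j f) (ihˣ i f))
            (cong (λ t → 2 * suc f * t) (ihˣ i (suc f)))) ⟩
  2 * i * (m * qy) + (2 + 2 * suc n) * (m * qx) + 2 * suc f * (m * qx′) + suc f * u
    + m * (u + (2 * i + 2 * f) * qx)
    ≡⟨ rhs f i n u qx qy qx′ ⟩
  suc (suc n) * u + K ∎)
  where
  open ≡-Reasoning
  m = suc n
  a = count (suc (suc n)) i j (suc f)
  x₁ = shiftˣ (count (suc n)) i j (suc f)
  x₂ = shiftˣ (count (suc n)) i j (suc (suc f))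
  y₁ = count (suc n) i j (suc f)
  u = shift^q (count (suc n)) i j f
  w = shift^q (shift^qf (count n)) i j f
  qx  = shiftˣ (shift^q (count n)) i j f
  qx′ = shiftˣ (shift^q (count n)) i j (suc f)
  qy  = shift^q (count n) i j f
  -- `K` gathers what cancels: the summand on the left of the recurrence for `a`, and `m` times the
  -- right side of the recurrence for `u`, whose last part `m * w` enters as `f * u`.
  K = (2 * i + 2 * suc f) * (m * qx) + m * (2 * i * qy + (2 + 2 * n) * qx + 2 * suc f * qx′) + f * u
  ihˣ : ∀ i f → suc f * shiftˣ (count (suc n)) i j (suc f) ≡ m * shiftˣ (shift^q (count n)) i j f
  ihˣ zero    f = trans (*-zeroʳ f) (sym (*-zeroʳ n))
  ihˣ (suc i) f = marked-fixed-point n i j f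
  ih-u : ∀ j f → f * shift^q (count (suc n)) i j f ≡ m * shift^q (shift^qf (count n)) i j f
  ih-u zero    f       = trans (*-zeroʳ f) (sym (*-zeroʳ n))
  ih-u (suc j) zero    = sym (*-zeroʳ n)
  ih-u (suc j) (suc f) = marked-fixed-point n i j f
  shiftˣ-q : ∀ i j f → shiftˣ (shift^q (count n)) i (suc j) f ≡ shiftˣ (count n) i j f
  shiftˣ-q zero    j f = refl
  shiftˣ-q (suc i) j f = refl
  shiftˣ-q-0 : ∀ i f → shiftˣ (shift^q (count n)) i zero f ≡ 0
  shiftˣ-q-0 zero    f = refl
  shiftˣ-q-0 (suc i) f = refl
  rec-u : ∀ j → shift^q (count (suc n)) i j f + (2 * i + 2 * f) * shiftˣ (shift^q (count n)) i j f
    ≡ 2 * i * shift^q (count n) i j f + (2 + 2 * n) * shiftˣ (shift^q (count n)) i j f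
      + 2 * suc f * shiftˣ (shift^q (count n)) i j (suc f) + shift^q (shift^qf (count n)) i j f
  rec-u zero rewrite shiftˣ-q-0 i f | shiftˣ-q-0 i (suc f) = zeros i f n
    where
    zeros : ∀ i f n → (2 * i + 2 * f) * 0 ≡ 2 * i * 0 + (2 + 2 * n) * 0 + 2 * suc f * 0 + 0
    zeros = solve-∀
  rec-u (suc j) rewrite shiftˣ-q i j f | shiftˣ-q i j (suc f) =
    count-recurrence n i j f
  lhs : ∀ f a i m qx qy qx′ n fu →
    suc f * a + ((2 * i + 2 * suc f) * (m * qx) + m * (2 * i * qy + (2 + 2 * n) * qx + 2 * suc f * qx′) + fu)
    ≡ suc f * a + (2 * i + 2 * suc f) * (m * qx) + (m * (2 * i * qy + (2 + 2 * n) * qx + 2 * suc f * qx′) + fu)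
  lhs = solve-∀
  factor : ∀ f a i x m s w →
    suc f * a + (2 * i + 2 * suc f) * (suc f * x) + (m * s + m * w)
    ≡ suc f * (a + (2 * i + 2 * suc f) * x) + m * (s + w)
  factor = solve-∀
  expand : ∀ f i y n x x′ u r →
    suc f * (2 * i * y + (2 + 2 * suc n) * x + 2 * suc (suc f) * x′ + u) + r
    ≡ 2 * i * (suc f * y) + (2 + 2 * suc n) * (suc f * x) + 2 * suc f * (suc (suc f) * x′) + suc f * u + r
  expand = solve-∀
  rhs : ∀ f i n u qx qy qx′ →
    2 * i * (suc n * qy) + (2 + 2 * suc n) * (suc n * qx) + 2 * suc f * (suc n * qx′) + suc f * u
      + suc n * (u + (2 * i + 2 * f) * qx)
    ≡ suc (suc n) * u
      + ((2 * i + 2 * suc f) * (suc n * qx) + suc n * (2 * i * qy + (2 + 2 * n) * qx + 2 * suc f * qx′) + f * u)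
  rhs = solve-∀

-- A new cycle is a fixed point, so it yields no derangement. Parents with exactly one fixed point
-- are traded for derangements of order `n`, with a factor q for the removed cycle.
derangement-recurrence : ∀ n i j →
  count (suc (suc n)) i j 0 + 2 * i * shiftˣ (count (suc n)) i j 0
  ≡ 2 * i * count (suc n) i j 0 + (2 + 2 * suc n) * shiftˣ (count (suc n)) i j 0
    + 2 * suc n * shiftˣ (shift^q (count n)) i j 0
derangement-recurrence n i j = begin
  count (suc (suc n)) i j 0 + 2 * i * x ≡⟨ cong (λ t → count (suc (suc n)) i j 0 + t * x) (+-identityʳ (2 * i)) ⟨
  count (suc (suc n)) i j 0 + (2 * i + 2 * 0) * x ≡⟨ count-recurrence (suc n) i j 0 ⟩
  2 * i * count (suc n) i j 0 + (2 + 2 * suc n) * x + 2 * shiftˣ (count (suc n)) i j 1 + 0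
    ≡⟨ +-identityʳ _ ⟩
  2 * i * count (suc n) i j 0 + (2 + 2 * suc n) * x + 2 * shiftˣ (count (suc n)) i j 1
    ≡⟨ cong (λ t → 2 * i * count (suc n) i j 0 + (2 + 2 * suc n) * x + t)
         (trans (cong (2 *_) (marked i)) (sym (*-assoc 2 (suc n) _))) ⟩
  _ ∎
  where
  open ≡-Reasoning
  x = shiftˣ (count (suc n)) i j 0
  marked : ∀ i → shiftˣ (count (suc n)) i j 1 ≡ suc n * shiftˣ (shift^q (count n)) i j 0
  marked zero    = sym (*-zeroʳ n)
  marked (suc i) = trans (sym (+-identityʳ _)) (marked-fixed-point n i j 0)

-- From counts to polynomials with integer coefficients

module _ (P : ℕ → Poly) (P-count : ∀ n i j → P n i j ≡ pos (count n i j 0)) where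

  xP-dx : ∀ p i j → xP (dx p) i j ≡ pos i *ℤ p i j
  xP-dx p zero    j = refl
  xP-dx p (suc i) j = refl

  qP-count : ∀ n i j → qP (P n) i j ≡ pos (shift^q (count n) i j 0)
  qP-count n i zero    = refl
  qP-count n i (suc j) = P-count n i j

  -- Only `P-count` is known of `P`, so the candidate list behind `R` does not unfold in this
  -- computation.
  recurrence : ∀ n → P (suc (suc n)) ≈P
    ((2 * suc n) ·P xP (P (suc n))
     +P 2 ·P (xP (dx (P (suc n))) -P xP (xP (dx (P (suc n)))))
     +P (2 * suc n) ·P xP (qP (P n)))
  recurrence n zero j =
    trans (P-count (suc (suc n)) 0 j) (trans (cong pos vanish) (sym (zerosℤ (pos (2 * suc n)))))
    where
    zeros : ∀ n → (2 + 2 * suc n) * 0 + 2 * suc n * 0 ≡ 0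
    zeros = solve-∀
    vanish : count (suc (suc n)) 0 j 0 ≡ 0
    vanish = trans (sym (+-identityʳ _)) (trans (derangement-recurrence n 0 j) (zeros n))
    zerosℤ : ∀ k → k *ℤ pos 0 +ℤ pos 0 +ℤ k *ℤ pos 0 ≡ pos 0
    zerosℤ = ℤ.solve-∀
  recurrence n (suc i) j
    = begin
    P (suc (suc n)) (suc i) j ≡⟨ P-count (suc (suc n)) (suc i) j ⟩
    pos (count (suc (suc n)) (suc i) j 0)
      ≡⟨ cast (count (suc (suc n)) (suc i) j 0) x y (shift^q (count n) i j 0) (2 * suc n)
           (derangement-recurrence n (suc i) j) ⟩
    k *ℤ pos x +ℤ pos 2 *ℤ (pos (suc i) *ℤ pos y -ℤ pos i *ℤ pos x)
      +ℤ k *ℤ pos (shift^q (count n) i j 0)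
      ≡⟨ cong₂ _+ℤ_ (cong₂ (λ s t → k *ℤ s +ℤ pos 2 *ℤ t) (P-count (suc n) i j)
           (cong₂ _-ℤ_ (cong (pos (suc i) *ℤ_) (P-count (suc n) (suc i) j))
             (trans (xP-dx (P (suc n)) i j) (cong (pos i *ℤ_) (P-count (suc n) i j)))))
           (cong (k *ℤ_) (qP-count n i j)) ⟨
    k *ℤ P (suc n) i j
      +ℤ pos 2 *ℤ (pos (suc i) *ℤ P (suc n) (suc i) j -ℤ xP (dx (P (suc n))) i j)
      +ℤ k *ℤ qP (P n) i j ∎
    where
    open ≡-Reasoning
    k = pos (2 * suc n)
    x = count (suc n) i j 0
    y = count (suc n) (suc i) j 0
    -- The 2 in `2 + k` turns the coefficient -2(1+i) of `x` into -2i, the one that -2x² ∂/∂x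
    -- produces at exponent 1+i.
    isolate : ∀ a i x y k q → a +ℤ (pos 2 *ℤ (pos 1 +ℤ i)) *ℤ x
                ≡ (pos 2 *ℤ (pos 1 +ℤ i)) *ℤ y +ℤ (pos 2 +ℤ k) *ℤ x +ℤ k *ℤ q →
              a ≡ k *ℤ x +ℤ pos 2 *ℤ ((pos 1 +ℤ i) *ℤ y -ℤ i *ℤ x) +ℤ k *ℤ q
    isolate a i x y k q eq = trans (l a i x)
      (trans (cong (_-ℤ (pos 2 *ℤ (pos 1 +ℤ i)) *ℤ x) eq) (r i x y k q))
      where
      l : ∀ a i x → a ≡ a +ℤ (pos 2 *ℤ (pos 1 +ℤ i)) *ℤ x -ℤ (pos 2 *ℤ (pos 1 +ℤ i)) *ℤ x
      l = ℤ.solve-∀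
      r : ∀ i x y k q →
        (pos 2 *ℤ (pos 1 +ℤ i)) *ℤ y +ℤ (pos 2 +ℤ k) *ℤ x +ℤ k *ℤ q -ℤ (pos 2 *ℤ (pos 1 +ℤ i)) *ℤ x
        ≡ k *ℤ x +ℤ pos 2 *ℤ ((pos 1 +ℤ i) *ℤ y -ℤ i *ℤ x) +ℤ k *ℤ q
      r = ℤ.solve-∀
    cast : ∀ a x y q k → a + 2 * suc i * x ≡ 2 * suc i * y + (2 + k) * x + k * q →
           pos a ≡ pos k *ℤ pos x +ℤ pos 2 *ℤ (pos (suc i) *ℤ pos y -ℤ pos i *ℤ pos x)
                   +ℤ pos k *ℤ pos q
    cast a x y q k eq = isolate (pos a) (pos i) (pos x) (pos y) (pos k) (pos q) (begin
      pos a +ℤ (pos 2 *ℤ pos (suc i)) *ℤ pos x ≡⟨ cong (λ t → pos a +ℤ t *ℤ pos x) (ℤ.pos-* 2 (suc i)) ⟨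
      pos a +ℤ pos (2 * suc i) *ℤ pos x        ≡⟨ cong (pos a +ℤ_) (ℤ.pos-* (2 * suc i) x) ⟨
      pos (a + 2 * suc i * x)                  ≡⟨ cong pos eq ⟩
      pos (2 * suc i * y) +ℤ pos ((2 + k) * x) +ℤ pos (k * q)
        ≡⟨ cong₂ _+ℤ_ (cong₂ _+ℤ_
             (trans (ℤ.pos-* (2 * suc i) y) (cong (_*ℤ pos y) (ℤ.pos-* 2 (suc i))))
             (ℤ.pos-* (2 + k) x)) (ℤ.pos-* k q) ⟩
      (pos 2 *ℤ pos (suc i)) *ℤ pos y +ℤ (pos 2 +ℤ pos k) *ℤ pos x +ℤ pos k *ℤ pos q ∎)

-- Reduction of words and the Boolean specification

distinct : Word → Word
distinct = deduplicate _≟_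

-- `red c` is `map (rank c) c` by definition, so reduction is a relabelling that the following
-- lemmas show to be strictly monotone on the letters of `c`.
rank : Word → ℕ → ℕ
rank c x = length (filter (λ y → y ≤? x) (distinct c))

unique-set⇒↭ : {A : Set} {xs ys : List A} → Unique xs → Unique ys →
               (∀ {x} → x ∈ xs → x ∈ ys) → (∀ {x} → x ∈ ys → x ∈ xs) → xs ↭ ys
unique-set⇒↭ uxs uys f g = ∼bag⇒↭ (unique∧set⇒bag uxs uys (mk⇔ f g))

rank-mono-⊆ : ∀ c {x y} → x ≤ y →
              filter (λ z → z ≤? x) (distinct c) ⊆ filter (λ z → z ≤? y) (distinct c)
rank-mono-⊆ c {x} {y} x≤y =
  ⊆.filter⁺ (λ z → z ≤? x) (λ z → z ≤? y) (λ { refl z≤x → ≤-trans z≤x x≤y }) (⊆-refl {x = distinct c})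

rank-mono-≤ : ∀ c {x y} → x ≤ y → rank c x ≤ rank c y
rank-mono-≤ c x≤y = length-mono-≤ (rank-mono-⊆ c x≤y)

-- The letters up to `x` form a sublist of those up to `y`. Equal lengths would make the two lists
-- equal and put `y` among the letters up to `x`.
rank-mono-< : ∀ c {x y} → y ∈ c → x < y → rank c x < rank c y
rank-mono-< c {x} {y} y∈c x<y = ≤∧≢⇒< (rank-mono-≤ c (<⇒≤ x<y)) λ eq →
  let y∈ = ∈-filter⁺ (λ z → z ≤? y) (∈-deduplicate⁺ _≟_ y∈c) ≤-refl
      same = Pointwise-≡⇒≡ (to-≋ eq (rank-mono-⊆ c (<⇒≤ x<y)))
      y≤x = proj₂ (∈-filter⁻ (λ z → z ≤? x) {xs = distinct c} (subst (y ∈_) (sym same) y∈))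
  in <⇒≱ x<y y≤x

rank-injective : ∀ c {x y} → x ∈ c → y ∈ c → rank c x ≡ rank c y → x ≡ y
rank-injective c {x} {y} x∈c y∈c eq with <-cmp x y
... | tri< x<y _ _ = contradiction eq (<⇒≢ (rank-mono-< c y∈c x<y))
... | tri≈ _ x≡y _ = x≡y
... | tri> _ _ y<x = contradiction eq (>⇒≢ (rank-mono-< c x∈c y<x))

⊆-map⁻ : {A B : Set} (f : A → B) (ys : List A) {xs : List B} → xs ⊆ map f ys →
         ∃ λ zs → xs ≡ map f zs × zs ⊆ ys
⊆-map⁻ f []       []         = [] , refl , []
⊆-map⁻ f (y ∷ ys) (_ ∷ʳ s)   = let zs , eq , t = ⊆-map⁻ f ys s in zs , eq , y ∷ʳ t
⊆-map⁻ f (y ∷ ys) (refl ∷ s) =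
  let zs , eq , t = ⊆-map⁻ f ys s in y ∷ zs , cong (f y ∷_) eq , refl ∷ t

-- A pattern of `red c` lifts to three letters of `c`; injectivity of the rank makes the outer two
-- equal, and strict monotonicity carries the inequality back.
Stirling-red⁺ : ∀ c → Stirling c → Stirling (red c)
Stirling-red⁺ c st s with ⊆-map⁻ (rank c) c s
... | u ∷ v ∷ t ∷ [] , eq , s′ with ∷-injectiveˡ eq | ∷-injectiveˡ (∷-injectiveʳ eq)
                         | ∷-injectiveˡ (∷-injectiveʳ (∷-injectiveʳ eq))
...   | refl | refl | u≡t with rank-injective c (to∈ (⊆-trans (refl ∷ minimum _) s′))
                                  (to∈ (⊆-trans (u ∷ʳ v ∷ʳ ⊆-refl) s′)) u≡t
...     | refl = rank-mono-< c (to∈ (⊆-trans (u ∷ʳ refl ∷ minimum _) s′)) (st s′)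

Stirling-red⁻ : ∀ c → Stirling (red c) → Stirling c
Stirling-red⁻ c st s = ≰⇒> λ y≤x → <⇒≱ (st (⊆.map⁺ (rank c) s)) (rank-mono-≤ c y≤x)

-- `size` and `each` give what `isPermOf2` asks of `red c`. `diversity` carries the induction: it
-- determines the rank of a new maximum.
record Reduced (c : Word) : Set where
  field
    size     : length c ≡ 2 * halfLen c
    diversity : length (distinct c) ≡ halfLen c
    each     : ∀ i → 1 ≤ i → i ≤ halfLen c → occ i (red c) ≡ 2

Reduced-[] : Reduced []
Reduced-[] = record { size = refl ; diversity = refl
                    ; each = λ i 1≤i i≤0 → contradiction (≤-trans 1≤i i≤0) λ () }

-- A new maximum leaves the ranks of the old letters unchanged and itself gets the next free rank,
-- so `red v` is `red w` with two copies of `suc k` added, up to order.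
Reduced-↭ : ∀ {N w v} → v ↭ N ∷ N ∷ w → All (_< N) w → Reduced w → Reduced v
Reduced-↭ {N} {w} {v} p w<N r = record
  { size = begin
      length v              ≡⟨ ↭-length p ⟩
      2 + length w          ≡⟨ cong (2 +_) size ⟩
      2 + 2 * halfLen w     ≡⟨ 2*suc (halfLen w) ⟨
      2 * suc (halfLen w)   ≡⟨ cong (2 *_) halfLen-v ⟨
      2 * halfLen v         ∎
  ; diversity = begin
      length (distinct v)     ≡⟨ ↭-length distinct-↭ ⟩
      suc (length (distinct w)) ≡⟨ cong suc diversity ⟩
      suc (halfLen w)         ≡⟨ halfLen-v ⟨
      halfLen v               ∎
  ; each = λ i 1≤i i≤ → trans (occ-↭ i red-↭) (each′ i 1≤i (subst (i ≤_) halfLen-v i≤))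
  }
  where
  open ≡-Reasoning
  open Reduced r
  k = halfLen w
  halfLen-v : halfLen v ≡ suc k
  halfLen-v = trans (cong (_/ 2) (↭-length p)) (m/n≡1+[m∸n]/n {2 + length w} {2} (s≤s (s≤s z≤n)))
  distinct-↭ : distinct v ↭ N ∷ distinct w
  distinct-↭ = unique-set⇒↭ (deduplicate-! _≟_ v)
    (All.tabulate (λ x∈ eq → >⇒≢ (All.lookup w<N (∈-deduplicate⁻ _≟_ w x∈)) eq) ∷ deduplicate-! _≟_ w)
    (λ x∈ → to (∈-resp-↭ p (∈-deduplicate⁻ _≟_ v x∈)))
    (λ x∈ → ∈-deduplicate⁺ _≟_ (∈-resp-↭ (↭-sym p) (from x∈)))
    where
    to : ∀ {x} → x ∈ N ∷ N ∷ w → x ∈ N ∷ distinct w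
    to (here eq)          = here eq
    to (there (here eq))  = here eq
    to (there (there x∈)) = there (∈-deduplicate⁺ _≟_ x∈)
    from : ∀ {x} → x ∈ N ∷ distinct w → x ∈ N ∷ N ∷ w
    from (here eq)  = here eq
    from (there x∈) = there (there (∈-deduplicate⁻ _≟_ w x∈))
  rank-N : rank v N ≡ suc k
  rank-N = trans (↭-length (filter-↭ (λ y → y ≤? N) distinct-↭))
    (trans (cong length (filter-all (λ y → y ≤? N) (≤-refl ∷
       All.tabulate (λ x∈ → <⇒≤ (All.lookup w<N (∈-deduplicate⁻ _≟_ w x∈))))))
     (cong suc diversity))
  rank-w : ∀ {x} → x < N → rank v x ≡ rank w x
  rank-w {x} x<N = trans (↭-length (filter-↭ (λ y → y ≤? x) distinct-↭))
    (cong length (filter-reject (λ y → y ≤? x) (<⇒≱ x<N)))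
  red-↭ : red v ↭ suc k ∷ suc k ∷ red w
  red-↭ = subst (red v ↭_)
    (cong₂ (λ s t → s ∷ s ∷ t) rank-N (map-cong-local (All.map rank-w w<N)))
    (↭.map⁺ (rank v) p)
  red≤k : All (_≤ k) (red w)
  red≤k = All.map⁺ (All.tabulate λ {x} _ →
    ≤-trans (length-filter (λ y → y ≤? x) (distinct w)) (≤-reflexive diversity))
  each′ : ∀ i → 1 ≤ i → i ≤ suc k → occ i (suc k ∷ suc k ∷ red w) ≡ 2
  each′ i 1≤i i≤1+k with suc k ≟ i
  ... | yes refl = trans (occ-NN-same (suc k) (red w))
                     (cong (2 +_) (occ-∉ (red w) (All.map (<⇒≢ ∘ s≤s) red≤k)))
  ... | no  k≢i  = trans (occ-NN-other (red w) k≢i) (each i 1≤i (s≤s⁻¹ (≤∧≢⇒< i≤1+k (k≢i ∘ sym))))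

Reduced-Child : ∀ {N σ τ} → Child N σ τ → All (All (_< N)) σ → All Reduced σ → All Reduced τ
Reduced-Child new        _         _        = Reduced-↭ ↭-refl [] Reduced-[] ∷ []
Reduced-Child (inside i) (c<N ∷ _) (r ∷ rs) = Reduced-↭ (Insert-↭ i) c<N r ∷ rs
Reduced-Child (skip ch)  (_ ∷ σ<N) (r ∷ rs) = r ∷ Reduced-Child ch σ<N rs

generated-reduced : ∀ n {σ} → σ ∈ generated n → All Reduced σ
generated-reduced zero    (here refl) = []
generated-reduced (suc n) τ∈ with find (∈-concatMap⁻ (children (suc n)) τ∈)
... | σ , σ∈ , τ∈′ = Reduced-Child (∈-children⁻ σ τ∈′)
  (below-suc (IsStirling².range (generated-sound n σ∈))) (generated-reduced n σ∈)

⊆-pair : ∀ (w : Word) (a b : Fin (length w)) → toℕ a < toℕ b → lookup w a ∷ lookup w b ∷ [] ⊆ w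
⊆-pair (x ∷ w) fzero    (fsuc b) _         = refl ∷ from∈ (∈-lookup b)
⊆-pair (x ∷ w) (fsuc a) (fsuc b) (s≤s a<b) = x ∷ʳ ⊆-pair w a b a<b

⊆-triple : ∀ (w : Word) (a b c : Fin (length w)) → toℕ a < toℕ b → toℕ b < toℕ c →
           lookup w a ∷ lookup w b ∷ lookup w c ∷ [] ⊆ w
⊆-triple (x ∷ w) fzero    (fsuc b) (fsuc c) _         (s≤s b<c) = refl ∷ ⊆-pair w b c b<c
⊆-triple (x ∷ w) (fsuc a) (fsuc b) (fsuc c) (s≤s a<b) (s≤s b<c) = x ∷ʳ ⊆-triple w a b c a<b b<c

index₁ : ∀ {w : Word} {x} → x ∷ [] ⊆ w → ∃ λ a → lookup w a ≡ x
index₁ (_ ∷ʳ s)   = let a , eq = index₁ s in fsuc a , eq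
index₁ (refl ∷ _) = fzero , refl

index₂ : ∀ {w : Word} {x y} → x ∷ y ∷ [] ⊆ w →
         ∃₂ λ a b → toℕ a < toℕ b × lookup w a ≡ x × lookup w b ≡ y
index₂ (_ ∷ʳ s)   = let a , b , lt , eqs = index₂ s in fsuc a , fsuc b , s≤s lt , eqs
index₂ (refl ∷ s) = let b , eq = index₁ s in fzero , fsuc b , s≤s z≤n , refl , eq

index₃ : ∀ {w : Word} {x y z} → x ∷ y ∷ z ∷ [] ⊆ w →
         ∃₂ λ a b → ∃ λ c → toℕ a < toℕ b × toℕ b < toℕ c ×
         lookup w a ≡ x × lookup w b ≡ y × lookup w c ≡ z
index₃ (_ ∷ʳ s)   =
  let a , b , c , a<b , b<c , eqs = index₃ s
  in fsuc a , fsuc b , fsuc c , s≤s a<b , s≤s b<c , eqs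
index₃ (refl ∷ s) =
  let b , c , b<c , eqs = index₂ s
  in fzero , fsuc b , fsuc c , s≤s z≤n , s≤s b<c , refl , eqs

T-⇒⁺ : ∀ {a b} → (T a → T b) → T (not a ∨ b)
T-⇒⁺ {false} _ = _
T-⇒⁺ {true}  f = f _

T-⇒⁻ : ∀ {a b} → T (not a ∨ b) → T a → T b
T-⇒⁻ {true} t _ = t

T-∧⁻ : ∀ {a b} → T (a ∧ b) → T a × T b
T-∧⁻ = Equivalence.to T-∧

T-∧⁺ : ∀ {a b} → T a → T b → T (a ∧ b)
T-∧⁺ ta tb = Equivalence.from T-∧ (ta , tb)

T-all⁻ : {A : Set} (p : A → Bool) {xs : List A} → T (all p xs) → ∀ {x} → x ∈ xs → T (p x)
T-all⁻ p {xs} t = All.lookup (All.all⁺ p xs t)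

T-all⁺ : {A : Set} (p : A → Bool) {xs : List A} → (∀ {x} → x ∈ xs → T (p x)) → T (all p xs)
T-all⁺ p f = All.all⁻ p (All.tabulate f)

stirlingAt : (w : Word) (a b c : Fin (length w)) → Bool
stirlingAt w a b c =
  not ((toℕ a <ᵇ toℕ b) ∧ (toℕ b <ᵇ toℕ c) ∧ (lookup w a ≡ᵇ lookup w c))
  ∨ (lookup w a <ᵇ lookup w b)

T-stirlingCond⁻ : ∀ w → T (stirlingCond w) → ∀ a b c → T (stirlingAt w a b c)
T-stirlingCond⁻ w t a b c =
  T-all⁻ (λ c → stirlingAt w a b c) {ps} (
  T-all⁻ (λ b → all (λ c → stirlingAt w a b c) ps) {ps} (
  T-all⁻ (λ a → all (λ b → all (λ c → stirlingAt w a b c) ps) ps) {ps} t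
    (∈-allFin a)) (∈-allFin b)) (∈-allFin c)
  where ps = allFin (length w)

T-stirlingCond⁺ : ∀ w → (∀ a b c → T (stirlingAt w a b c)) → T (stirlingCond w)
T-stirlingCond⁺ w f =
  T-all⁺ (λ a → all (λ b → all (λ c → stirlingAt w a b c) ps) ps) {ps} λ {a} _ →
  T-all⁺ (λ b → all (λ c → stirlingAt w a b c) ps) {ps} λ {b} _ →
  T-all⁺ (λ c → stirlingAt w a b c) {ps} λ {c} _ → f a b c
  where ps = allFin (length w)

stirlingCond-sound : ∀ w → T (stirlingCond w) → Stirling w
stirlingCond-sound w t s with index₃ s
... | a , b , c , a<b , b<c , refl , refl , eq =
  <ᵇ⇒< (lookup w a) (lookup w b) (T-⇒⁻ (T-stirlingCond⁻ w t a b c)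
    (T-∧⁺ (<⇒<ᵇ a<b) (T-∧⁺ (<⇒<ᵇ b<c) (≡⇒≡ᵇ (lookup w a) (lookup w c) (sym eq)))))

stirlingCond-complete : ∀ w → Stirling w → T (stirlingCond w)
stirlingCond-complete w st = T-stirlingCond⁺ w λ a b c → T-⇒⁺ λ t →
  let a<b , t′ = T-∧⁻ {toℕ a <ᵇ toℕ b} t
      b<c , eq = T-∧⁻ {toℕ b <ᵇ toℕ c} t′
  in <⇒<ᵇ (st (subst (λ z → lookup w a ∷ lookup w b ∷ z ∷ [] ⊆ w)
       (sym (≡ᵇ⇒≡ (lookup w a) (lookup w c) eq))
       (⊆-triple w a b c (<ᵇ⇒< (toℕ a) (toℕ b) a<b) (<ᵇ⇒< (toℕ b) (toℕ c) b<c))))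

∈-oneTo⁺ : ∀ {n i} → 1 ≤ i → i ≤ n → i ∈ oneTo n
∈-oneTo⁺ {i = suc i} _ i<n = ∈-applyUpTo⁺ suc i<n

∈-oneTo⁻ : ∀ {n i} → i ∈ oneTo n → 1 ≤ i × i ≤ n
∈-oneTo⁻ i∈ with ∈-applyUpTo⁻ suc i∈
... | _ , j<n , refl = s≤s z≤n , j<n

isPermOf2-sound : ∀ k w → T (isPermOf2 k w) →
  length w ≡ 2 * k × (∀ i → 1 ≤ i → i ≤ k → occ i w ≡ 2)
isPermOf2-sound k w t =
  let len , each = T-∧⁻ {length w ≡ᵇ 2 * k} t
  in ≡ᵇ⇒≡ _ _ len , λ i 1≤i i≤k → ≡ᵇ⇒≡ _ _ (T-all⁻ (λ i → occ i w ≡ᵇ 2) each (∈-oneTo⁺ 1≤i i≤k))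

isPermOf2-complete : ∀ k w → length w ≡ 2 * k → (∀ i → 1 ≤ i → i ≤ k → occ i w ≡ 2) →
  T (isPermOf2 k w)
isPermOf2-complete k w len each = T-∧⁺ (≡⇒≡ᵇ _ _ len)
  (T-all⁺ (λ i → occ i w ≡ᵇ 2) λ i∈ → let 1≤i , i≤k = ∈-oneTo⁻ i∈ in ≡⇒≡ᵇ _ _ (each _ 1≤i i≤k))

firstIsMin-sound : ∀ c → T (firstIsMin c) → LeadingMin c
firstIsMin-sound (x ∷ c) t = leadingMin (All.tabulate λ y∈ →
  s≤s⁻¹ (<ᵇ⇒< _ _ (T-all⁻ (λ y → x ≤ᵇ' y) t y∈)))

firstIsMin-complete : ∀ {c} → LeadingMin c → T (firstIsMin c)
firstIsMin-complete (leadingMin {x} x≤c) =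
  T-all⁺ (λ y → x ≤ᵇ' y) λ y∈ → <⇒<ᵇ (s≤s (All.lookup x≤c y∈))

increasingHeads-sound : ∀ σ → T (increasingHeads σ) → Increasing σ
increasingHeads-sound []          _ = []
increasingHeads-sound (c ∷ [])    _ = [-]
increasingHeads-sound (c ∷ d ∷ σ) t =
  let lt , t′ = T-∧⁻ {head0 c <ᵇ head0 d} t
  in <ᵇ⇒< _ _ lt ∷ increasingHeads-sound (d ∷ σ) t′

increasingHeads-complete : ∀ {σ} → Increasing σ → T (increasingHeads σ)
increasingHeads-complete []       = _
increasingHeads-complete [-]      = _
increasingHeads-complete (lt ∷ l) = T-∧⁺ (<⇒<ᵇ lt) (increasingHeads-complete l)

inQ2-sound : ∀ n σ → T (inQ2 n σ) → All (_∈ oneTo n) (concat σ) → IsStirling² n σ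
inQ2-sound n σ t σ⊆ =
  let _ , t₁       = T-∧⁻ {not (null σ)} t
      perm , t₂    = T-∧⁻ {isPermOf2 n (concat σ)} t₁
      cI , t₃      = T-∧⁻ {condI σ} t₂
      cII , cIII   = T-∧⁻ {condII σ} t₃
      mins , incr  = T-∧⁻ {all firstIsMin σ} cII
      len , each   = isPermOf2-sound n (concat σ) perm
  in record
  { cycles = All.tabulate λ {c} c∈ → record
      { twice    = All.tabulate λ x∈ → ≡ᵇ⇒≡ _ _ (T-all⁻ (λ x → occ x c ≡ᵇ 2) (T-all⁻ _ cI c∈) x∈)
      ; leading  = firstIsMin-sound c (T-all⁻ firstIsMin mins c∈)
      ; stirling = Stirling-red⁻ c (stirlingCond-sound (red c)
          (proj₂ (T-∧⁻ {isPermOf2 (halfLen c) (red c)} (T-all⁻ (λ c → inQ (halfLen c) (red c)) cIII c∈))))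
      }
  ; heads = increasingHeads-sound σ incr
  ; range = All.map ∈-oneTo⁻ σ⊆
  ; len   = len
  ; each  = each
  }

inQ2-complete : ∀ n σ → IsStirling² (suc n) σ → All Reduced σ → T (inQ2 (suc n) σ)
inQ2-complete n σ st rs =
  T-∧⁺ (not-null σ len)
  (T-∧⁺ (isPermOf2-complete (suc n) (concat σ) len each)
  (T-∧⁺ (T-all⁺ (λ c → all (λ x → occ x c ≡ᵇ 2) c) λ {c} c∈ → T-all⁺ (λ x → occ x c ≡ᵇ 2) λ x∈ →
          ≡⇒≡ᵇ _ _ (All.lookup (StirlingCycle.twice (All.lookup cycles c∈)) x∈))
  (T-∧⁺ (T-∧⁺ (T-all⁺ firstIsMin λ c∈ → firstIsMin-complete (StirlingCycle.leading (All.lookup cycles c∈)))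
              (increasingHeads-complete heads))
  (T-all⁺ (λ c → inQ (halfLen c) (red c)) λ {c} c∈ →
    let r = All.lookup rs c∈ in
    T-∧⁺ (isPermOf2-complete (halfLen c) (red c) (trans (length-map (rank c) c) (Reduced.size r))
                              (Reduced.each r))
         (stirlingCond-complete (red c) (Stirling-red⁺ c (StirlingCycle.stirling (All.lookup cycles c∈))))))))
  where
  open IsStirling² st
  not-null : ∀ σ → length (concat σ) ≡ 2 * suc n → T (not (null σ))
  not-null (_ ∷ _) _ = _

-- In one direction the range of the letters comes from membership in `candidates`; in the other,
-- `generated-reduced` supplies that reduced cycles are permutations.
enumeration : ∀ n → filterᵇ (inQ2 (suc n)) (candidates (suc n)) ↭ generated (suc n)
enumeration n = unique-set⇒↭
  (Unique.filter⁺ (T? ∘ inQ2 (suc n)) (candidates-unique (suc n))) (generated-unique (suc n))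
  (λ {σ} σ∈ → let σ∈′ , t = ∈-filter⁻ (T? ∘ inQ2 (suc n)) {xs = candidates (suc n)} σ∈ in
    generated-complete (suc n) (inQ2-sound (suc n) σ t (∈-candidates⁻ (suc n) σ∈′)))
  (λ {σ} σ∈ → let st = generated-sound (suc n) σ∈; open IsStirling² st in
    ∈-filter⁺ (T? ∘ inQ2 (suc n))
      (∈-candidates⁺ (suc n) σ (nonEmpties cycles) (All.map (λ (l , u) → ∈-oneTo⁺ l u) range) len)
      (inQ2-complete n σ st (generated-reduced (suc n) σ∈)))

-- The coefficients of R_n as counts of generated elements

length-filterᵇ-∧ : {A : Set} (p q r : A → Bool) (xs : List A) →
  length (filterᵇ (λ x → (p x ∧ q x) ∧ r x) xs) ≡ ∑ (filterᵇ p xs) (λ x → ⟦ q x ∧ r x ⟧)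
length-filterᵇ-∧ p q r []       = refl
length-filterᵇ-∧ p q r (x ∷ xs) with p x
... | false = length-filterᵇ-∧ p q r xs
... | true with q x ∧ r x
...   | true  = cong suc (length-filterᵇ-∧ p q r xs)
...   | false = length-filterᵇ-∧ p q r xs

isDerangement-fix : ∀ σ → isDerangement σ ≡ (fix σ ≡ᵇ 0)
isDerangement-fix []      = refl
isDerangement-fix (c ∷ σ) with isFixedCycle c
... | true  = refl
... | false = isDerangement-fix σ

R-count : ∀ n i j → R n i j ≡ pos (count n i j 0)
R-count zero    zero    zero    = refl
R-count zero    zero    (suc j) = refl
R-count zero    (suc i) j       = refl
R-count (suc n) i       j       = cong pos (begin
  length (filterᵇ (λ σ → inDQ (suc n) σ ∧ (cap σ ≡ᵇ i) ∧ (cyc σ ≡ᵇ j)) (candidates (suc n)))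
    ≡⟨ length-filterᵇ-∧ (inQ2 (suc n)) isDerangement
         (λ σ → (cap σ ≡ᵇ i) ∧ (cyc σ ≡ᵇ j)) (candidates (suc n)) ⟩
  ∑ (filterᵇ (inQ2 (suc n)) (candidates (suc n))) weight
    ≡⟨ sum-↭ (↭.map⁺ weight (enumeration n)) ⟩
  ∑ (generated (suc n)) weight
    ≡⟨ ∑-cong (All.tabulate {xs = generated (suc n)} λ {σ} _ →
         cong ⟦_⟧ (reorder (cap σ ≡ᵇ i) (cyc σ ≡ᵇ j) (isDerangement-fix σ))) ⟩
  count (suc n) i j 0 ∎)
  where
  open ≡-Reasoning
  weight : Cycles → ℕ
  weight σ = ⟦ isDerangement σ ∧ (cap σ ≡ᵇ i) ∧ (cyc σ ≡ᵇ j) ⟧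
  reorder : ∀ a b {d e} → d ≡ e → d ∧ a ∧ b ≡ a ∧ b ∧ e
  reorder true  true  {true}  refl = refl
  reorder true  true  {false} refl = refl
  reorder true  false {true}  refl = refl
  reorder true  false {false} refl = refl
  reorder false _     {true}  refl = refl
  reorder false _     {false} refl = refl

-- Initial values

R₀ : R 0 ≈P 1P
R₀ zero    zero    = refl
R₀ zero    (suc j) = refl
R₀ (suc i) j       = refl

R₁ : R 1 ≈P 0P
R₁ i j = trans (R-count 1 i j) (cong pos (vanish i j))
  where
  vanish : ∀ i j → count 1 i j 0 ≡ 0
  vanish (suc i) j             = refl
  vanish zero    zero          = refl
  vanish zero    (suc zero)    = refl
  vanish zero    (suc (suc j)) = refl

R₂ : R 2 ≈P 2 ·P qP (xP 1P)
R₂ i j = trans (R-count 2 i j) (value i j)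
  where
  value : ∀ i j → pos (count 2 i j 0) ≡ (2 ·P qP (xP 1P)) i j
  value zero          zero                = refl
  value zero          (suc zero)          = refl
  value zero          (suc (suc zero))    = refl
  value zero          (suc (suc (suc j))) = refl
  value (suc zero)    zero                = refl
  value (suc zero)    (suc zero)          = refl
  value (suc zero)    (suc (suc j))       = refl
  value (suc (suc i)) zero                = refl
  value (suc (suc i)) (suc zero)          = refl
  value (suc (suc i)) (suc (suc j))       = refl

-- The evaluation runs over the 1·3·5 = 15 elements of `generated 3` in place of the 3^6 · 2^5
-- candidates. The cases go just beyond the largest values of the statistics, after which all
-- indicators compute to 0.
R₃ : R 3 ≈P 4 ·P (qP (xP 1P) +P qP (xP (xP 1P)))
R₃ i j = trans (R-count 3 i j) (value i j)
  where
  value : ∀ i j → pos (count 3 i j 0) ≡ (4 ·P (qP (xP 1P) +P qP (xP (xP 1P)))) i j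
  value zero                zero                      = refl
  value zero                (suc zero)                = refl
  value zero                (suc (suc zero))          = refl
  value zero                (suc (suc (suc zero)))    = refl
  value zero                (suc (suc (suc (suc j)))) = refl
  value (suc zero)          zero                      = refl
  value (suc zero)          (suc zero)                = refl
  value (suc zero)          (suc (suc zero))          = refl
  value (suc zero)          (suc (suc (suc j)))       = refl
  value (suc (suc zero))    zero                      = refl
  value (suc (suc zero))    (suc zero)                = refl
  value (suc (suc zero))    (suc (suc zero))          = refl
  value (suc (suc zero))    (suc (suc (suc j)))       = refl
  value (suc (suc (suc i))) zero                      = refl
  value (suc (suc (suc i))) (suc zero)                = refl
  value (suc (suc (suc i))) (suc (suc j))             = refl

theorem17 : ((n : ℕ) →
    R (suc (suc n)) ≈P
    ((2 * suc n) ·P xP (R (suc n))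
    +P 2 ·P (xP (dx (R (suc n))) -P xP (xP (dx (R (suc n)))))
    +P (2 * suc n) ·P xP (qP (R n))))
    × (R 0 ≈P 1P)
    × (R 1 ≈P 0P)
    × (R 2 ≈P 2 ·P qP (xP 1P))
    × (R 3 ≈P 4 ·P (qP (xP 1P) +P qP (xP (xP 1P))))
theorem17 = recurrence R R-count , R₀ , R₁ , R₂ , R₃
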